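{- For any $\tau\in[2,\infty]$ there exist uncountably many elements $\xi\in\mathcal{C}$ with irrationality exponent $\tau(\xi)=\tau$.
   Context: $\mathbb{F}_3$ is the field with $3$ elements. $\mathbb{F}_3((X^{ -1}))$ is the field of formal Laurent series $\sum_{n=-N}^{\infty}a_{ -n}X^{ -n}$ with $a_{ -n}\in\mathbb{F}_3$, with ultrametric absolute value $|0|=0$ and $\left|\sum_{n=-N}^{\infty}a_{ -n}X^{ -n}\right|=3^N$ when $a_N\neq 0$; it is the completion of $\mathbb{F}_3(X)$ with respect to $|P|=3^{\deg P}$. The Cantor set is $\mathcal{C}=\{\sum_{n\ge 1}a_{ -n}X^{ -n}: a_{ -n}\in\{0,2\}\text{ for all }n\}$. The irrationality exponent of $\xi\in\mathbb{F}_3((X^{ -1}))$ is $$\tau(\xi)=\sup\left\{\tau:\left|\xi-\tfrac{g}{h}\right|<|h|^{ -\tau}\text{ for infinitely many }\tfrac{g}{h}\in\mathbb{F}_3(X)\right\},$$ where $g,h\in\mathbb{F}_3[X]$, $h\ne0$. -}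

module Defs where

open import Data.Fin.Base using (Fin; toℕ)
open import Data.Fin.Patterns using (0F; 1F; 2F)
open import Data.Integer.Base as ℤ using (ℤ; +_; -[1+_]; 0ℤ; 1ℤ)
import Data.Integer.Properties as ℤₚ
open import Data.List.Base using (List; []; _∷_)
import Data.List.Membership.Setoid as Membership
open import Data.Nat.Base as ℕ using (ℕ)
open import Data.Nat.DivMod using (_mod_)
open import Data.Product.Base using (_×_; _,_; ∃; ∃-syntax)
open import Data.Rational.Base as ℚ using (ℚ; ↥_; ↧ₙ_; 0ℚ; 1/_)
import Data.Rational.Properties as ℚₚ
open import Data.Sum.Base using (_⊎_; inj₁; inj₂)
open import Function.Base using (_∘_)
open import Level using (Level; 0ℓ)
open import Relation.Binary.Bundles using (Setoid)
open import Relation.Binary.Definitions using (tri<; tri≈; tri>)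
open import Relation.Binary.PropositionalEquality
  using (_≡_; _≢_; refl; sym; trans; cong; cong₂; subst)
open import Relation.Nullary.Construct.Add.Supremum using (_⁺; [_])
import Relation.Binary.Construct.Add.Supremum.Strict as AddSupremum
open import Relation.Nullary.Negation.Core using (¬_)
open import Relation.Unary using (Pred)

------------------------------------------------------------------------
-- Infinite and uncountable subsets of a setoid

module _ {c ℓ : Level} (S : Setoid c ℓ) where

  open Setoid S using (Carrier; _≈_)
  open Membership S using (_∉_)

  -- No finite list exhausts P.
  Infinite : ∀ {p} → Pred Carrier p → Set _
  Infinite P = (xs : List Carrier) → ∃[ x ] (P x × x ∉ xs)

  -- No sequence exhausts P.
  Uncountable : ∀ {p} → Pred Carrier p → Set _
  Uncountable P = (f : ℕ → Carrier) → ∃[ x ] (P x × (∀ n → ¬ (x ≈ f n)))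

------------------------------------------------------------------------
-- Real numbers, as two-sided Dedekind cuts

record ℝ : Set₁ where
  field
    -- L q means q < x and U q means x < q
    L U       : Pred ℚ 0ℓ
    L-inhab   : ∃ L
    U-inhab   : ∃ U
    L-lower   : ∀ {p q} → p ℚ.< q → L q → L p
    U-upper   : ∀ {p q} → p ℚ.< q → U p → U q
    L-rounded : ∀ {p} → L p → ∃[ q ] (p ℚ.< q × L q)
    U-rounded : ∀ {q} → U q → ∃[ p ] (p ℚ.< q × U p)
    disjoint  : ∀ {q} → ¬ (L q × U q)
    located   : ∀ {p q} → p ℚ.< q → L p ⊎ U q

open ℝ public using (L; U)

infix 4 _<ℝ_

_<ℝ_ : ℝ → ℝ → Set
x <ℝ y = ∃[ q ] (U x q × L y q)

fromℚ : ℚ → ℝ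
fromℚ r = record
  { L         = ℚ._< r
  ; U         = r ℚ.<_
  ; L-inhab   = r ℚ.- ℚ.1ℚ , r-1<r
  ; U-inhab   = r ℚ.+ ℚ.1ℚ , r<r+1
  ; L-lower   = ℚₚ.<-trans
  ; U-upper   = λ p<q r<p → ℚₚ.<-trans r<p p<q
  ; L-rounded = λ p<r → let q , p<q , q<r = ℚₚ.<-dense p<r in q , p<q , q<r
  ; U-rounded = λ r<q → let p , r<p , p<q = ℚₚ.<-dense r<q in p , p<q , r<p
  ; disjoint  = λ (q<r , r<q) → ℚₚ.<-asym q<r r<q
  ; located   = located
  }
  where
  r-1<r : r ℚ.- ℚ.1ℚ ℚ.< r
  r-1<r = subst (r ℚ.- ℚ.1ℚ ℚ.<_) (ℚₚ.+-identityʳ r)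
            (ℚₚ.+-monoʳ-< r (ℚₚ.negative⁻¹ (ℚ.- ℚ.1ℚ)))

  r<r+1 : r ℚ.< r ℚ.+ ℚ.1ℚ
  r<r+1 = subst (ℚ._< r ℚ.+ ℚ.1ℚ) (ℚₚ.+-identityʳ r)
            (ℚₚ.+-monoʳ-< r (ℚₚ.positive⁻¹ ℚ.1ℚ))

  located : ∀ {p q} → p ℚ.< q → p ℚ.< r ⊎ r ℚ.< q
  located {p} p<q with ℚₚ.<-cmp p r
  ... | tri< p<r _ _  = inj₁ p<r
  ... | tri≈ _ refl _ = inj₂ p<q
  ... | tri> _ _ r<p  = inj₂ (ℚₚ.<-trans r<p p<q)

-- ℝ ⁺ is (-∞,∞], with ⊤⁺ in the role of ∞.
open AddSupremum _<ℝ_ public using (_<⁺_)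

infix 4 _≤⁺_

_≤⁺_ : ℝ ⁺ → ℝ ⁺ → Set₁
σ ≤⁺ τ = ¬ (τ <⁺ σ)

record IsSupremum {a} (A : Pred ℝ a) (τ : ℝ ⁺) : Set (Level.suc 0ℓ Level.⊔ a) where
  field
    upperBound : ∀ t → A t → [ t ] ≤⁺ τ
    least      : ∀ s → [ s ] <⁺ τ → ∃[ t ] (A t × s <ℝ t)

------------------------------------------------------------------------
-- Powers

open import Algebra.Definitions.RawSemiring ℚ.+-*-rawSemiring public using (_^_)

infixr 8 _^ᶻ_

_^ᶻ_ : (b : ℚ) .{{_ : ℚ.NonZero b}} → ℤ → ℚ
b ^ᶻ (+ n)    = b ^ n
b ^ᶻ -[1+ n ] = (1/ b) ^ ℕ.suc n

-- a < b^(-r) for 0 ≤ a, 0 < b and rational r = m/n : both sides are raised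
-- to the power n > 0.
_<_^-ℚ_ : (a b : ℚ) .{{_ : ℚ.NonZero b}} → ℚ → Set
a < b ^-ℚ r = a ^ (↧ₙ r) ℚ.< b ^ᶻ (ℤ.- (↥ r))

-- a < b^(-t) for 0 ≤ a, 0 < b and real t : as s ↦ b^(-s) is continuous and
-- monotone (in a direction depending on b), the inequality holds at t iff it
-- holds at both ends of some rational interval around t.
_<_^-ℝ_ : (a b : ℚ) .{{_ : ℚ.NonZero b}} → ℝ → Set
a < b ^-ℝ t =
  ∃[ r ] ∃[ s ] (L t r × U t s × (a < b ^-ℚ r) × (a < b ^-ℚ s))

------------------------------------------------------------------------
-- The field with three elements

𝔽₃ : Set
𝔽₃ = Fin 3

infixl 6 _+₃_
infixl 7 _*₃_
infix  8 -₃_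

_+₃_ _*₃_ : 𝔽₃ → 𝔽₃ → 𝔽₃
a +₃ b = (toℕ a ℕ.+ toℕ b) mod 3
a *₃ b = (toℕ a ℕ.* toℕ b) mod 3

-₃_ : 𝔽₃ → 𝔽₃
-₃ a = (3 ℕ.∸ toℕ a) mod 3

------------------------------------------------------------------------
-- Formal Laurent series in X⁻¹ over 𝔽₃

record 𝕂 : Set where
  field
    -- coeff i is the coefficient of X^i (i may be negative).
    coeff   : ℤ → 𝔽₃
    bound   : ℤ
    bounded : ∀ i → bound ℤ.< i → coeff i ≡ 0F

open 𝕂 public

infix 4 _≈_

_≈_ : 𝕂 → 𝕂 → Set
x ≈ y = ∀ i → coeff x i ≡ coeff y i

𝕂-setoid : Setoid 0ℓ 0ℓ
𝕂-setoid = record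
  { Carrier       = 𝕂
  ; _≈_           = _≈_
  ; isEquivalence = record
    { refl  = λ _ → refl
    ; sym   = λ p i → sym (p i)
    ; trans = λ p q i → trans (p i) (q i)
    }
  }

0𝕂 1𝕂 : 𝕂
0𝕂 = record { coeff = λ _ → 0F ; bound = 0ℤ ; bounded = λ _ _ → refl }
1𝕂 = record { coeff = δ ; bound = 0ℤ ; bounded = vanish }
  where
  δ : ℤ → 𝔽₃
  δ (+ 0) = 1F
  δ _     = 0F

  vanish : ∀ i → 0ℤ ℤ.< i → δ i ≡ 0F
  vanish (+ ℕ.suc _) _ = refl
  vanish (+ 0) (ℤ.+<+ ())

infixl 6 _+ᴷ_ _-ᴷ_
infix  8 -ᴷ_
infixr 7 _∙_ _·_

_+ᴷ_ : 𝕂 → 𝕂 → 𝕂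
x +ᴷ y = record
  { coeff   = λ i → coeff x i +₃ coeff y i
  ; bound   = bound x ℤ.⊔ bound y
  ; bounded = λ i b<i → cong₂ _+₃_
      (bounded x i (ℤₚ.≤-<-trans (ℤₚ.i≤i⊔j (bound x) (bound y)) b<i))
      (bounded y i (ℤₚ.≤-<-trans (ℤₚ.i≤j⊔i (bound x) (bound y)) b<i))
  }

-ᴷ_ : 𝕂 → 𝕂
-ᴷ x = record
  { coeff   = λ i → -₃ coeff x i
  ; bound   = bound x
  ; bounded = λ i b<i → cong -₃_ (bounded x i b<i)
  }

_-ᴷ_ : 𝕂 → 𝕂 → 𝕂
x -ᴷ y = x +ᴷ (-ᴷ y)

_∙_ : 𝔽₃ → 𝕂 → 𝕂
a ∙ x = record
  { coeff   = λ i → a *₃ coeff x i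
  ; bound   = bound x
  ; bounded = λ i b<i → trans (cong (a *₃_) (bounded x i b<i)) (a*0 a)
  }
  where
  a*0 : ∀ a → a *₃ 0F ≡ 0F
  a*0 0F = refl
  a*0 1F = refl
  a*0 2F = refl

-- Multiplication by X
X·_ : 𝕂 → 𝕂
X· x = record
  { coeff   = λ i → coeff x (ℤ.pred i)
  ; bound   = ℤ.suc (bound x)
  ; bounded = λ i b<i → bounded x (ℤ.pred i)
      (subst (ℤ._< ℤ.pred i) (ℤₚ.pred-suc (bound x)) (ℤₚ.+-monoʳ-< ℤ.-1ℤ b<i))
  }

-- Absolute value: ∣ x ∣≐ a is the graph of x ↦ |x|, given as a relation
-- because x ≈ 0𝕂 is undecidable.
∣_∣≐_ : 𝕂 → ℚ → Set
∣ x ∣≐ a =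
    (x ≈ 0𝕂 × a ≡ 0ℚ)
  ⊎ (∃[ N ] (coeff x N ≢ 0F
           × (∀ i → N ℤ.< i → coeff x i ≡ 0F)
           × a ≡ (+ 3 ℚ./ 1) ^ᶻ N))

------------------------------------------------------------------------
-- Polynomials and rational functions

-- Coefficient lists, constant term first; trailing zeros are allowed.
𝔽₃[X] : Set
𝔽₃[X] = List 𝔽₃

-- Product of a polynomial and a Laurent series
_·_ : 𝔽₃[X] → 𝕂 → 𝕂
[]      · x = 0𝕂
(a ∷ p) · x = (a ∙ x) +ᴷ (X· (p · x))

ι : 𝔽₃[X] → 𝕂
ι p = p · 1𝕂

-- 𝔽₃(X) is viewed as a subfield of 𝕂, so that equality of fractions is _≈_.
-- As 𝕂 is a field, x = g/h means that h ≠ 0 and h·x = g.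
record _IsQuotient_/_ (x : 𝕂) (g h : 𝔽₃[X]) : Set where
  field
    h≉0   : ¬ (ι h ≈ 0𝕂)
    h·x≈g : h · x ≈ ι g

------------------------------------------------------------------------
-- Irrationality exponent and Cantor set

-- x is some g/h in 𝔽₃(X) with |ξ - g/h| < |h|^(-t).
record Approximates (ξ : 𝕂) (t : ℝ) (x : 𝕂) : Set where
  field
    g h        : 𝔽₃[X]
    x≐g/h      : x IsQuotient g / h
    ∣ξ-x∣ ∣h∣  : ℚ
    ∣ξ-x∣-abs  : ∣ ξ -ᴷ x ∣≐ ∣ξ-x∣
    ∣h∣-abs    : ∣ ι h ∣≐ ∣h∣
    {{∣h∣≢0}}  : ℚ.NonZero ∣h∣
    inequality : ∣ξ-x∣ < ∣h∣ ^-ℝ t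

IrrationalityExponent : 𝕂 → ℝ ⁺ → Set₁
IrrationalityExponent ξ =
  IsSupremum (λ t → Infinite 𝕂-setoid (Approximates ξ t))

Cantor : Pred 𝕂 0ℓ
Cantor ξ =
    (∀ i → 0ℤ ℤ.≤ i → coeff ξ i ≡ 0F)
  × (∀ i → i ℤ.< 0ℤ → coeff ξ i ≡ 0F ⊎ coeff ξ i ≡ 2F)

module Submission where

-- Take ξ = 2 Σ X^(-n j) with n (suc j) ≥ 2 n j and n (suc j) / n j → τ. The partial
-- sums, with denominators X^(n j), show that the irrationality exponent is at least τ.
-- That it is at most τ is a folding argument: for a polynomial h of degree d < n (suc j),
-- the fractional part of h ξ has a nonzero digit at an index k ≤ d + G d, where
-- G bounds the gaps n (suc j) − 2 n j. In the upper part of the range of d, the pair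
-- (d , k) is the mirror image (n (suc j) − k′ , n (suc j) − d′) of a pair (d′ , k′) for
-- the low part of h and the preceding partial sum, with k − d = k′ − d′ and d′ ≤ d.
-- Each n (suc j) may still be moved by one, which is used to make ξ differ from the
-- j-th series of a given sequence.

open import Defs
open import Algebra.Properties.CommutativeSemigroup using (x∙yz≈y∙xz)
open import Data.Fin.Patterns using (0F; 1F; 2F)
import Data.Fin.Properties as Finₚ
open import Data.Integer.Base as ℤ using (ℤ; +_; -[1+_]; 0ℤ; 1ℤ; _⊖_)
import Data.Integer.Properties as ℤₚ
open import Data.Integer.Tactic.RingSolver using (solve-∀)
open import Data.List.Base using (List; []; _∷_; allFin; applyUpTo; cartesianProductWith)
open import Data.List.Membership.Propositional using (_∈_; lose)
open import Data.List.Membership.Propositional.Properties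
  using (∈-allFin; ∈-cartesianProductWith⁺)
import Data.List.Membership.Setoid as Membership
open import Data.List.Relation.Unary.Any using (Any; here; there)
open import Data.Nat.Base as ℕ using (ℕ; zero; suc; _+_; _*_; _∸_; _≤_; _<_)
import Data.Nat.DivMod as ℕ
import Data.Nat.Properties as ℕₚ
import Data.Nat.Tactic.RingSolver as ℕ-Solver
open import Data.Product.Base using (_×_; _,_; ∃; ∃-syntax; proj₁; proj₂)
open import Data.Rational.Base as ℚ using (ℚ; ↥_; ↧_; ↧ₙ_; 1ℚ; 1/_; _/_)
import Data.Rational.Properties as ℚₚ
open import Data.Rational.Unnormalised.Base as ℚᵘ using (mkℚᵘ)
import Data.Rational.Unnormalised.Properties as ℚᵘₚ
open import Data.Sum.Base using (_⊎_; inj₁; inj₂)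
open import Data.Unit.Base using (⊤; tt)
open import Function.Base using (_∘_)
open import Relation.Binary.Bundles using (Setoid)
open import Relation.Binary.Construct.Add.Supremum.Strict _<ℝ_ using ([_]; [_]<⊤⁺)
open import Relation.Binary.Definitions using (tri<; tri≈; tri>)
open import Relation.Binary.PropositionalEquality
  using (_≡_; _≢_; refl; sym; trans; cong; cong₂; subst; subst₂; module ≡-Reasoning)
open import Relation.Nullary.Construct.Add.Supremum using (_⁺; [_]; ⊤⁺)
open import Relation.Nullary.Decidable using (yes; no; from-yes; _→-dec_)
open import Relation.Nullary.Negation.Core using (¬_; contradiction)
open import Relation.Unary using (Pred)

-- Arithmetic of 𝔽₃

+₃-identityˡ : ∀ a → 0F +₃ a ≡ a
+₃-identityˡ = from-yes (Finₚ.all? λ a → 0F +₃ a Finₚ.≟ a)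

+₃-identityʳ : ∀ a → a +₃ 0F ≡ a
+₃-identityʳ = from-yes (Finₚ.all? λ a → a +₃ 0F Finₚ.≟ a)

*₃-zeroʳ : ∀ a → a *₃ 0F ≡ 0F
*₃-zeroʳ = from-yes (Finₚ.all? λ a → a *₃ 0F Finₚ.≟ 0F)

*₃-identityʳ : ∀ a → a *₃ 1F ≡ a
*₃-identityʳ = from-yes (Finₚ.all? λ a → a *₃ 1F Finₚ.≟ a)

+₃-inverseʳ : ∀ a → a +₃ -₃ a ≡ 0F
+₃-inverseʳ = from-yes (Finₚ.all? λ a → a +₃ -₃ a Finₚ.≟ 0F)

a-b≡0⇒a≡b : ∀ a b → a +₃ -₃ b ≡ 0F → a ≡ b
a-b≡0⇒a≡b = from-yes (Finₚ.all? λ a → Finₚ.all? λ b →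
  (a +₃ -₃ b Finₚ.≟ 0F) →-dec (a Finₚ.≟ b))

a*b≡0⇒b≡0 : ∀ a b → a ≢ 0F → a *₃ b ≡ 0F → b ≡ 0F
a*b≡0⇒b≡0 0F b a≢0 _ = contradiction refl a≢0
a*b≡0⇒b≡0 1F 0F _ _ = refl
a*b≡0⇒b≡0 2F 0F _ _ = refl
a*b≡0⇒b≡0 1F 1F _ ()
a*b≡0⇒b≡0 1F 2F _ ()
a*b≡0⇒b≡0 2F 1F _ ()
a*b≡0⇒b≡0 2F 2F _ ()

-- With the two lemmas after it, the inductive step at one coefficient in the proof that
-- multiplication by a fixed polynomial is linear. Exhaustion over 𝔽₃ replaces a derivation from
-- ring laws.
mul-+-step : ∀ a x y u v →
  a *₃ (x +₃ y) +₃ (u +₃ v) ≡ (a *₃ x +₃ u) +₃ (a *₃ y +₃ v)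
mul-+-step = from-yes (Finₚ.all? λ a → Finₚ.all? λ x → Finₚ.all? λ y →
  Finₚ.all? λ u → Finₚ.all? λ v →
  a *₃ (x +₃ y) +₃ (u +₃ v) Finₚ.≟ (a *₃ x +₃ u) +₃ (a *₃ y +₃ v))

mul-∙-step : ∀ a c x u → a *₃ (c *₃ x) +₃ c *₃ u ≡ c *₃ (a *₃ x +₃ u)
mul-∙-step = from-yes (Finₚ.all? λ a → Finₚ.all? λ c → Finₚ.all? λ x →
  Finₚ.all? λ u → a *₃ (c *₃ x) +₃ c *₃ u Finₚ.≟ c *₃ (a *₃ x +₃ u))

mul-neg-step : ∀ a x u → a *₃ (-₃ x) +₃ -₃ u ≡ -₃ (a *₃ x +₃ u)
mul-neg-step = from-yes (Finₚ.all? λ a → Finₚ.all? λ x → Finₚ.all? λ u →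
  a *₃ (-₃ x) +₃ -₃ u Finₚ.≟ -₃ (a *₃ x +₃ u))

-- Multiplication of Laurent series by polynomials

VanishesAbove : ℤ → 𝕂 → Set
VanishesAbove M x = ∀ i → M ℤ.< i → coeff x i ≡ 0F

-- Multiplication by X^(-n). The bound of `x` is kept, since any upper bound will do.
shift : ℕ → 𝕂 → 𝕂
shift n x = record
  { coeff   = λ i → coeff x (+ n ℤ.+ i)
  ; bound   = bound x
  ; bounded = λ i b<i → bounded x (+ n ℤ.+ i)
      (ℤₚ.<-≤-trans b<i (ℤₚ.i≤j+i i (+ n)))
  }

·-distribˡ-+ᴷ : ∀ p x y → p · (x +ᴷ y) ≈ (p · x) +ᴷ (p · y)
·-distribˡ-+ᴷ []      x y i = refl
·-distribˡ-+ᴷ (a ∷ p) x y i = trans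
  (cong (a *₃ (coeff x i +₃ coeff y i) +₃_) (·-distribˡ-+ᴷ p x y (ℤ.pred i)))
  (mul-+-step a (coeff x i) (coeff y i) _ _)

·-∙-comm : ∀ p c x → p · (c ∙ x) ≈ c ∙ (p · x)
·-∙-comm []      c x i = sym (*₃-zeroʳ c)
·-∙-comm (a ∷ p) c x i = trans
  (cong (a *₃ (c *₃ coeff x i) +₃_) (·-∙-comm p c x (ℤ.pred i)))
  (mul-∙-step a c (coeff x i) _)

·-neg : ∀ p x → p · (-ᴷ x) ≈ -ᴷ (p · x)
·-neg []      x i = refl
·-neg (a ∷ p) x i = trans
  (cong (a *₃ (-₃ coeff x i) +₃_) (·-neg p x (ℤ.pred i)))
  (mul-neg-step a (coeff x i) _)

x-y≡0⇒x≡y : ∀ x y i → coeff (x -ᴷ y) i ≡ 0F → coeff x i ≡ coeff y i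
x-y≡0⇒x≡y x y i = a-b≡0⇒a≡b (coeff x i) (coeff y i)

x≡y⇒x-y≡0 : ∀ x y i → coeff x i ≡ coeff y i → coeff (x -ᴷ y) i ≡ 0F
x≡y⇒x-y≡0 x y i x≡y = trans (cong (_+₃ -₃ coeff y i) x≡y) (+₃-inverseʳ (coeff y i))

·-distribˡ--ᴷ : ∀ p x y → p · (x -ᴷ y) ≈ (p · x) -ᴷ (p · y)
·-distribˡ--ᴷ p x y i = trans (·-distribˡ-+ᴷ p x (-ᴷ y) i)
  (cong (coeff (p · x) i +₃_) (·-neg p y i))

·-shift : ∀ p n x → p · shift n x ≈ shift n (p · x)
·-shift []      n x i = refl
·-shift (a ∷ p) n x i = cong (a *₃ coeff x (+ n ℤ.+ i) +₃_)
  (trans (·-shift p n x (ℤ.pred i)) (cong (coeff (p · x)) (lemma (+ n) i)))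
  where
  lemma : ∀ n i → n ℤ.+ (ℤ.-1ℤ ℤ.+ i) ≡ ℤ.-1ℤ ℤ.+ (n ℤ.+ i)
  lemma = solve-∀

ι-neg : ∀ p k → coeff (ι p) -[1+ k ] ≡ 0F
ι-neg []      k = refl
ι-neg (a ∷ p) k = cong₂ _+₃_ (*₃-zeroʳ a) (ι-neg p (suc k))

ι-head : ∀ a p → coeff (ι (a ∷ p)) 0ℤ ≡ a
ι-head a p = trans (cong₂ _+₃_ (*₃-identityʳ a) (ι-neg p 0)) (+₃-identityʳ a)

ι-tail : ∀ a p n → coeff (ι (a ∷ p)) (+ suc n) ≡ coeff (ι p) (+ n)
ι-tail a p n = trans (cong (_+₃ coeff (ι p) (+ n)) (*₃-zeroʳ a)) (+₃-identityˡ _)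

-- A zero polynomial may be a nonempty list of zeros, so polynomials are tested through the
-- coefficients of `ι p` and not through the shape of the list.
·-zero : ∀ p x → (∀ n → coeff (ι p) (+ n) ≡ 0F) → p · x ≈ 0𝕂
·-zero []      x p≡0 i = refl
·-zero (a ∷ p) x p≡0 i = cong₂ _+₃_
  (cong (_*₃ coeff x i) (trans (sym (ι-head a p)) (p≡0 0)))
  (·-zero p x (λ n → trans (sym (ι-tail a p n)) (p≡0 (suc n))) (ℤ.pred i))

·-vanishesAbove : ∀ p d x M → (∀ n → d ℕ.< n → coeff (ι p) (+ n) ≡ 0F) →
  VanishesAbove M x → VanishesAbove (M ℤ.+ + d) (p · x)
·-vanishesAbove []      d       x M p≡0 x≡0 i M+d<i = refl
·-vanishesAbove (a ∷ p) zero    x M p≡0 x≡0 i M+d<i = cong₂ _+₃_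
  (trans (cong (a *₃_) (x≡0 i (subst (ℤ._< i) (ℤₚ.+-identityʳ M) M+d<i))) (*₃-zeroʳ a))
  (·-zero p x (λ n → trans (sym (ι-tail a p n)) (p≡0 (suc n) (ℕ.s≤s ℕ.z≤n))) (ℤ.pred i))
·-vanishesAbove (a ∷ p) (suc d) x M p≡0 x≡0 i M+d<i = cong₂ _+₃_
  (trans (cong (a *₃_) (x≡0 i (ℤₚ.≤-<-trans (ℤₚ.i≤i+j M (+ suc d)) M+d<i))) (*₃-zeroʳ a))
  (·-vanishesAbove p d x M
    (λ n d<n → trans (sym (ι-tail a p n)) (p≡0 (suc n) (ℕ.s≤s d<n))) x≡0 (ℤ.pred i)
    (subst (ℤ._< ℤ.pred i) (lemma M (+ d)) (ℤₚ.+-monoʳ-< ℤ.-1ℤ M+d<i)))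
  where
  lemma : ∀ M d → ℤ.-1ℤ ℤ.+ (M ℤ.+ (1ℤ ℤ.+ d)) ≡ M ℤ.+ d
  lemma = solve-∀

M<M+1+d : ∀ M d → M ℤ.< M ℤ.+ + suc d
M<M+1+d M d = subst (ℤ._< M ℤ.+ + suc d) (ℤₚ.+-identityʳ M)
  (ℤₚ.+-monoʳ-< M (ℤ.+<+ (ℕ.s≤s ℕ.z≤n)))

·-top : ∀ p d x M → (∀ n → d ℕ.< n → coeff (ι p) (+ n) ≡ 0F) →
  VanishesAbove M x → coeff (p · x) (M ℤ.+ + d) ≡ coeff (ι p) (+ d) *₃ coeff x M
·-top []      d       x M p≡0 x≡0 = refl
·-top (a ∷ p) zero    x M p≡0 x≡0 = trans (cong₂ _+₃_
  (cong₂ _*₃_ (sym (ι-head a p)) (cong (coeff x) (ℤₚ.+-identityʳ M)))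
  (·-zero p x (λ n → trans (sym (ι-tail a p n)) (p≡0 (suc n) (ℕ.s≤s ℕ.z≤n))) _))
  (+₃-identityʳ _)
·-top (a ∷ p) (suc d) x M p≡0 x≡0 = trans (cong₂ _+₃_
  (trans (cong (a *₃_) (x≡0 _ (M<M+1+d M d))) (*₃-zeroʳ a))
  (trans (cong (coeff (p · x)) (lemma M (+ d)))
    (trans (·-top p d x M (λ n d<n → trans (sym (ι-tail a p n)) (p≡0 (suc n) (ℕ.s≤s d<n))) x≡0)
      (cong (_*₃ coeff x M) (sym (ι-tail a p d))))))
  (+₃-identityˡ _)
  where
  lemma : ∀ M d → ℤ.-1ℤ ℤ.+ (M ℤ.+ (1ℤ ℤ.+ d)) ≡ M ℤ.+ d
  lemma = solve-∀

-- Downwards from the bound of x: each top coefficient of x is read off p · x.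
·-cancel-zero : ∀ p d x → coeff (ι p) (+ d) ≢ 0F →
  (∀ n → d ℕ.< n → coeff (ι p) (+ n) ≡ 0F) → p · x ≈ 0𝕂 → x ≈ 0𝕂
·-cancel-zero p d x pd≢0 p≡0 px≈0 i =
  let k , b-i<k = below (bound x ℤ.- i) in
  vanish k i (subst₂ ℤ._<_ (left (bound x) i (+ k)) (right (+ k) i)
    (ℤₚ.+-monoˡ-< (i ℤ.- + k) b-i<k))
  where
  below : ∀ z → ∃[ k ] z ℤ.< + k
  below (+ n)    = suc n , ℤ.+<+ (ℕₚ.n<1+n n)
  below -[1+ n ] = 0 , ℤ.-<+

  left : ∀ b i k → b ℤ.- i ℤ.+ (i ℤ.- k) ≡ b ℤ.- k
  left = solve-∀

  right : ∀ k i → k ℤ.+ (i ℤ.- k) ≡ i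
  right = solve-∀

  next : ∀ b k → 1ℤ ℤ.+ (b ℤ.- (1ℤ ℤ.+ k)) ≡ b ℤ.- k
  next = solve-∀

  vanish : ∀ k → VanishesAbove (bound x ℤ.- + k) x
  vanish zero    i b<i = bounded x i (subst (ℤ._< i) (ℤₚ.+-identityʳ (bound x)) b<i)
  vanish (suc k) i b<i with ℤₚ.<-cmp (bound x ℤ.- + k) i
  ... | tri< b-k<i _ _ = vanish k i b-k<i
  ... | tri≈ _ refl _ = a*b≡0⇒b≡0 _ _ pd≢0
    (trans (sym (·-top p d x i p≡0 (vanish k))) (px≈0 _))
  ... | tri> _ _ i<b-k = contradiction
    (subst (ℤ._≤ i) (next (bound x) (+ k)) (ℤₚ.i<j⇒suc[i]≤j b<i)) (ℤₚ.<⇒≱ i<b-k)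

-- Products of a polynomial with lacunary partial sums

extend-zero : ∀ {H : ℕ → 𝔽₃} {m} → H m ≡ 0F →
  ∀ i → i < suc m → (i < m → H i ≡ 0F) → H i ≡ 0F
extend-zero Hm≡0 i i≤m H≡0 with ℕₚ.m≤n⇒m<n∨m≡n (ℕ.s≤s⁻¹ i≤m)
... | inj₁ i<m  = H≡0 i<m
... | inj₂ refl = Hm≡0

last-nonzero : (H : ℕ → 𝔽₃) (m : ℕ) →
  (∀ i → i < m → H i ≡ 0F) ⊎
  ∃[ d ] (d < m × H d ≢ 0F × (∀ i → d < i → i < m → H i ≡ 0F))
last-nonzero H zero    = inj₁ λ _ ()
last-nonzero H (suc m) with H m Finₚ.≟ 0F
... | no Hm≢0  = inj₂ (m , ℕₚ.≤-refl , Hm≢0 ,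
  λ i m<i i≤m → contradiction i≤m (ℕₚ.<⇒≱ (ℕ.s≤s m<i)))
... | yes Hm≡0 with last-nonzero H m
...   | inj₁ H≡0 = inj₁ λ i i≤m → extend-zero {H} Hm≡0 i i≤m (H≡0 i)
...   | inj₂ (d , d<m , Hd≢0 , H≡0) =
  inj₂ (d , ℕₚ.m<n⇒m<1+n d<m , Hd≢0 , λ i d<i i≤m → extend-zero {H} Hm≡0 i i≤m (H≡0 i d<i))

-- H i and b j k are the coefficients of Xⁱ in h and of X⁻ᵏ in the product of h
-- and the j-th partial sum.
module Gaps
  (n : ℕ → ℕ) (n₀ : n 0 ≡ 0) (double : ∀ j → n j + n j ≤ n (suc j))
  (G : ℕ → ℕ) (G-mono : ∀ {d e} → d ≤ e → G d ≤ G e)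
  (gap : ∀ j → n (suc j) ≤ n j + n j + G (n j))
  (H : ℤ → 𝔽₃) (H-neg : ∀ i → H -[1+ i ] ≡ 0F)
  (b : ℕ → ℕ → 𝔽₃) (b-zero : ∀ k → b 0 k ≡ 0F)
  (b-suc : ∀ j k → b (suc j) k ≡ b j k +₃ 2F *₃ H (n (suc j) ⊖ k))
  where

  n-step : ∀ j → n j ≤ n (suc j)
  n-step j = ℕₚ.≤-trans (ℕₚ.m≤m+n (n j) (n j)) (double j)

  n≤N∸n : ∀ j → n j ≤ n (suc j) ∸ n j
  n≤N∸n j = ℕₚ.m+n≤o⇒m≤o∸n (n j) (double j)

  n<N∸d : ∀ j d → d < n (suc j) ∸ n j → n j < n (suc j) ∸ d
  n<N∸d j d d<N∸n = ℕₚ.m+n≤o⇒m≤o∸n (suc (n j)) (subst (_≤ n (suc j))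
    (trans (ℕₚ.+-comm (suc d) (n j)) (ℕₚ.+-suc (n j) d))
    (ℕₚ.m≤o∸n⇒m+n≤o (suc d) (n-step j) d<N∸n))

  H-below : ∀ {N k} → N < k → H (N ⊖ k) ≡ 0F
  H-below {N} {k} N<k = trans (cong H (ℤₚ.⊖-< N<k)) (neg (ℕₚ.m<n⇒0<n∸m N<k))
    where
    neg : ∀ {m} → 0 < m → H (ℤ.- + m) ≡ 0F
    neg {suc m} _ = H-neg m

  H-above : ∀ {N k} → k ≤ N → H (N ⊖ k) ≡ H (+ (N ∸ k))
  H-above k≤N = cong H (ℤₚ.⊖-≥ k≤N)

  b-suc-same : ∀ j k → H (n (suc j) ⊖ k) ≡ 0F → b (suc j) k ≡ b j k
  b-suc-same j k H≡0 = trans (b-suc j k)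
    (trans (cong (λ c → b j k +₃ 2F *₃ c) H≡0) (+₃-identityʳ _))

  b-beyond : ∀ j k → n j < k → b j k ≡ 0F
  b-beyond zero    k _   = b-zero k
  b-beyond (suc j) k N<k = trans (b-suc-same j k (H-below N<k))
    (b-beyond j k (ℕₚ.≤-<-trans (n-step j) N<k))

  -- For k > 0 the first j terms only bring in coefficients `H` at indices n l - k < n j.
  b-low : ∀ j → (∀ i → i < n j → H (+ i) ≡ 0F) → ∀ k → 0 < k → b j k ≡ 0F
  b-low zero    _   k _   = b-zero k
  b-low (suc j) H≡0 k 0<k = trans (b-suc-same j k H[N-k]≡0)
    (b-low j (λ i i<n → H≡0 i (ℕₚ.<-≤-trans i<n (n-step j))) k 0<k)
    where
    H[N-k]≡0 : H (n (suc j) ⊖ k) ≡ 0F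
    H[N-k]≡0 with k ℕₚ.≤? n (suc j)
    ... | yes k≤N = trans (H-above k≤N)
      (H≡0 _ (ℕₚ.∸-monoʳ-< 0<k k≤N))
    ... | no k≰N = H-below (ℕₚ.≰⇒> k≰N)

  -- Where the earlier terms contribute nothing the new one cannot be cancelled: the digit is 2
  -- times `H (+ d)`.
  b-suc-single : ∀ j d → d ≤ n (suc j) → b j (n (suc j) ∸ d) ≡ 0F →
    H (+ d) ≢ 0F → b (suc j) (n (suc j) ∸ d) ≢ 0F
  b-suc-single j d d≤N bj≡0 Hd≢0 b≡0 = Hd≢0 (a*b≡0⇒b≡0 2F _ (λ ()) (begin
    2F *₃ H (+ d)                 ≡⟨ cong (λ e → 2F *₃ H (+ e)) (ℕₚ.m∸[m∸n]≡n d≤N) ⟨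
    2F *₃ H (+ (N ∸ (N ∸ d)))     ≡⟨ cong (2F *₃_) (H-above (ℕₚ.m∸n≤m N d)) ⟨
    2F *₃ H (N ⊖ (N ∸ d))         ≡⟨ +₃-identityˡ _ ⟨
    0F +₃ 2F *₃ H (N ⊖ (N ∸ d))   ≡⟨ cong (_+₃ 2F *₃ H (N ⊖ (N ∸ d))) bj≡0 ⟨
    b j (N ∸ d) +₃ 2F *₃ H (N ⊖ (N ∸ d)) ≡⟨ b-suc j (N ∸ d) ⟨
    b (suc j) (N ∸ d)             ≡⟨ b≡0 ⟩
    0F ∎))
    where
    open ≡-Reasoning
    N = n (suc j)

  -- 0 < k makes this a digit of the fractional part; k ≤ n j keeps it out of reach of the later
  -- terms when h has degree less than n j.
  SmallIndex : ℕ → ℕ → Set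
  SmallIndex j d = ∃[ k ] (0 < k × k ≤ n j × b j k ≢ 0F × k ≤ d + G d)

  -- Induction on j. `H` is constrained only at indices below n j, so that the induction hypothesis
  -- also covers the low part of a polynomial of larger degree.
  small-index : ∀ j d → d < n j → H (+ d) ≢ 0F →
    (∀ i → d < i → i < n j → H (+ i) ≡ 0F) → SmallIndex j d
  small-index zero    d d<0 = contradiction (subst (d <_) n₀ d<0) (ℕₚ.n≮0)
  small-index (suc j) d d<N Hd≢0 H≡0 with d ℕₚ.<? n j | d ℕₚ.<? n (suc j) ∸ n j
  -- The digit found for j survives: the new term adds the coefficient at N - k, and d < n j ≤ N - k
  -- < N.
  ... | yes d<n | _ =
    let k , 0<k , k≤n , bk≢0 , k≤ = small-index j d d<n Hd≢0
          (λ i d<i i<n → H≡0 i d<i (ℕₚ.<-≤-trans i<n (n-step j)))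
        k≤N = ℕₚ.≤-trans k≤n (n-step j)
        n≤N∸k = ℕₚ.≤-trans (n≤N∸n j) (ℕₚ.∸-monoʳ-≤ (n (suc j)) k≤n)
    in k , 0<k , k≤N
      , (λ b≡0 → bk≢0 (trans (sym (b-suc-same j k (trans (H-above k≤N)
          (H≡0 _ (ℕₚ.<-≤-trans d<n n≤N∸k) (ℕₚ.∸-monoʳ-< 0<k k≤N))))) b≡0))
      , k≤
  -- The leading coefficient of h lands at N - d > n j, beyond all digits of the previous product.
  ... | no d≮n | yes d<N∸n =
    N ∸ d , ℕₚ.m<n⇒0<n∸m d<N , ℕₚ.m∸n≤m N d
    , b-suc-single j d (ℕₚ.<⇒≤ d<N) (b-beyond j _ (n<N∸d j d d<N∸n)) Hd≢0
    , ℕₚ.m≤n+o⇒m∸n≤o N d (begin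
        N                        ≤⟨ gap j ⟩
        n j + n j + G (n j)      ≤⟨ ℕₚ.+-mono-≤ (ℕₚ.+-mono-≤ n≤d n≤d) (G-mono n≤d) ⟩
        d + d + G d              ≡⟨ ℕₚ.+-assoc d d (G d) ⟩
        d + (d + G d)            ∎)
    where
    open ℕₚ.≤-Reasoning
    N = n (suc j)
    n≤d = ℕₚ.≮⇒≥ d≮n
  -- Now N - d ≤ n j, where old digits may cancel new ones. Coefficients at indices below N - n j
  -- land beyond n j, so the last nonzero one among them, at d′, gives a safe digit at N - d′.
  ... | no d≮n | no d≮N∸n with last-nonzero (H ∘ +_) (n (suc j) ∸ n j)
  ...   | inj₁ H≡0′ =
    N ∸ d , ℕₚ.m<n⇒0<n∸m d<N , ℕₚ.m∸n≤m N d
    , b-suc-single j d (ℕₚ.<⇒≤ d<N) (b-low j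
        (λ i i<n → H≡0′ i (ℕₚ.<-≤-trans i<n (n≤N∸n j))) _
        (ℕₚ.m<n⇒0<n∸m d<N)) Hd≢0
    , ℕₚ.≤-trans N∸d≤n (ℕₚ.≤-trans n≤d (ℕₚ.m≤m+n d (G d)))
    where
    N = n (suc j)
    n≤d = ℕₚ.≮⇒≥ d≮n
    N∸d≤n : N ∸ d ≤ n j
    N∸d≤n = ℕₚ.≤-trans (ℕₚ.∸-monoʳ-≤ N (ℕₚ.≮⇒≥ d≮N∸n)) (ℕₚ.≤-reflexive (ℕₚ.m∸[m∸n]≡n (n-step j)))
  ...   | inj₂ (d′ , d′<N∸n , Hd′≢0 , H≡0′) = go
    where
    open ℕₚ.≤-Reasoning
    N = n (suc j)
    n≤d = ℕₚ.≮⇒≥ d≮n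
    N∸n≤d = ℕₚ.≮⇒≥ d≮N∸n
    d′<N = ℕₚ.<-≤-trans d′<N∸n (ℕₚ.m∸n≤m N (n j))

    mirror : N ∸ d′ ≤ d + G d → SmallIndex (suc j) d
    mirror small = N ∸ d′ , ℕₚ.m<n⇒0<n∸m d′<N , ℕₚ.m∸n≤m N d′
      , b-suc-single j d′ (ℕₚ.<⇒≤ d′<N) (b-beyond j _ (n<N∸d j d′ d′<N∸n)) Hd′≢0 , small

    go : SmallIndex (suc j) d
    go with d′ ℕₚ.<? n j
    -- Here N - d′ ≤ N - n j ≤ d already.
    ... | no d′≮n = mirror (begin
      N ∸ d′  ≤⟨ ℕₚ.∸-monoʳ-≤ N (ℕₚ.≮⇒≥ d′≮n) ⟩
      N ∸ n j ≤⟨ N∸n≤d ⟩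
      d       ≤⟨ ℕₚ.m≤m+n d (G d) ⟩
      d + G d ∎)
    ... | yes d′<n with small-index j d′ d′<n Hd′≢0
          (λ i d′<i i<n → H≡0′ i d′<i (ℕₚ.<-≤-trans i<n (n≤N∸n j)))
    ...   | k , 0<k , k≤n , bk≢0 , k≤ with b (suc j) k Finₚ.≟ 0F
    ...     | no b≢0 = k , 0<k , ℕₚ.≤-trans k≤n (n-step j) , b≢0
      , ℕₚ.≤-trans k≤n (ℕₚ.≤-trans n≤d (ℕₚ.m≤m+n d (G d)))
    -- The digit at k was cancelled, so h has a nonzero coefficient at N - k and N - k ≤ d. With k ≤
    -- d′ + G d′ this bounds N - d′.
    ...     | yes b≡0 = mirror (ℕₚ.m≤n+o⇒m∸n≤o N d′ (begin
      N                ≤⟨ subst (N ≤_) (ℕₚ.+-comm k d) (ℕₚ.≤-trans (ℕₚ.m≤n+m∸n N k) (ℕₚ.+-monoʳ-≤ k N∸k≤d)) ⟩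
      d + k            ≤⟨ ℕₚ.+-monoʳ-≤ d (ℕₚ.≤-trans k≤ (ℕₚ.+-monoʳ-≤ d′ (G-mono d′≤d))) ⟩
      d + (d′ + G d)   ≡⟨ x∙yz≈y∙xz ℕₚ.+-commutativeSemigroup d d′ (G d) ⟩
      d′ + (d + G d)   ∎))
      where
      d′≤d = ℕₚ.≤-trans (ℕₚ.<⇒≤ d′<N∸n) N∸n≤d
      k≤N = ℕₚ.≤-trans k≤n (n-step j)

      N∸k≤d : N ∸ k ≤ d
      N∸k≤d = ℕₚ.≮⇒≥ λ d<N∸k → bk≢0 (trans (sym (b-suc-same j k
        (trans (H-above k≤N) (H≡0 _ d<N∸k (ℕₚ.∸-monoʳ-< 0<k k≤N))))) b≡0)

-- Integer powers

-- `_^ᶻ_` is defined by the sign of the exponent. Its laws follow from the single recursion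
-- `^ᶻ-suc`, used upwards and, by cancelling one factor, downwards.
ℤ-induction : ∀ {p} (P : ℤ → Set p) → P 0ℤ →
  (∀ i → P i → P (ℤ.suc i)) → (∀ i → P (ℤ.suc i) → P i) → ∀ i → P i
ℤ-induction P P0 up down (+ zero)       = P0
ℤ-induction P P0 up down (+ suc n)      = up (+ n) (ℤ-induction P P0 up down (+ n))
ℤ-induction P P0 up down -[1+ zero ]    = down -[1+ 0 ] P0
ℤ-induction P P0 up down -[1+ suc n ]   = down -[1+ suc n ] (ℤ-induction P P0 up down -[1+ n ])

*-cancelˡ-≡ : ∀ a .{{_ : ℚ.NonZero a}} {x y} → a ℚ.* x ≡ a ℚ.* y → x ≡ y
*-cancelˡ-≡ a {x} {y} ax≡ay = begin
  x                    ≡⟨ cancel x ⟨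
  1/ a ℚ.* (a ℚ.* x)   ≡⟨ cong (1/ a ℚ.*_) ax≡ay ⟩
  1/ a ℚ.* (a ℚ.* y)   ≡⟨ cancel y ⟩
  y                    ∎
  where
  open ≡-Reasoning
  cancel : ∀ z → 1/ a ℚ.* (a ℚ.* z) ≡ z
  cancel z = trans (sym (ℚₚ.*-assoc (1/ a) a z))
    (trans (cong (ℚ._* z) (ℚₚ.*-inverseˡ a)) (ℚₚ.*-identityˡ z))

module _ (b : ℚ) .{{_ : ℚ.NonZero b}} where

  open ≡-Reasoning

  ^ᶻ-suc : ∀ i → b ^ᶻ ℤ.suc i ≡ b ℚ.* b ^ᶻ i
  ^ᶻ-suc (+ n)        = refl
  ^ᶻ-suc -[1+ zero ]  = sym (trans (cong (b ℚ.*_) (ℚₚ.*-identityʳ (1/ b))) (ℚₚ.*-inverseʳ b))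
  ^ᶻ-suc -[1+ suc n ] = begin
    (1/ b) ^ suc n                       ≡⟨ ℚₚ.*-identityˡ _ ⟨
    1ℚ ℚ.* (1/ b) ^ suc n                ≡⟨ cong (ℚ._* (1/ b) ^ suc n) (ℚₚ.*-inverseʳ b) ⟨
    (b ℚ.* 1/ b) ℚ.* (1/ b) ^ suc n      ≡⟨ ℚₚ.*-assoc b (1/ b) _ ⟩
    b ℚ.* (1/ b) ^ suc (suc n)           ∎

  ^ᶻ-homo-+ : ∀ i j → b ^ᶻ (i ℤ.+ j) ≡ b ^ᶻ i ℚ.* b ^ᶻ j
  ^ᶻ-homo-+ i j = ℤ-induction (λ i → b ^ᶻ (i ℤ.+ j) ≡ b ^ᶻ i ℚ.* b ^ᶻ j)
    (trans (cong (b ^ᶻ_) (ℤₚ.+-identityˡ j)) (sym (ℚₚ.*-identityˡ _)))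
    (λ i eq → trans (lhs i) (trans (cong (b ℚ.*_) eq) (sym (rhs i))))
    (λ i eq → *-cancelˡ-≡ b (trans (sym (lhs i)) (trans eq (rhs i)))) i
    where
    lhs : ∀ i → b ^ᶻ (ℤ.suc i ℤ.+ j) ≡ b ℚ.* b ^ᶻ (i ℤ.+ j)
    lhs i = trans (cong (b ^ᶻ_) (ℤₚ.+-assoc 1ℤ i j)) (^ᶻ-suc (i ℤ.+ j))

    rhs : ∀ i → b ^ᶻ ℤ.suc i ℚ.* b ^ᶻ j ≡ b ℚ.* (b ^ᶻ i ℚ.* b ^ᶻ j)
    rhs i = trans (cong (ℚ._* b ^ᶻ j) (^ᶻ-suc i)) (ℚₚ.*-assoc b _ _)

module _ (b : ℚ) .{{_ : ℚ.NonZero b}} where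

  ^ᶻ-* : ∀ i .{{_ : ℚ.NonZero (b ^ᶻ i)}} j → (b ^ᶻ i) ^ᶻ j ≡ b ^ᶻ (i ℤ.* j)
  ^ᶻ-* i j = ℤ-induction (λ j → (b ^ᶻ i) ^ᶻ j ≡ b ^ᶻ (i ℤ.* j))
    (cong (b ^ᶻ_) (sym (ℤₚ.*-zeroʳ i)))
    (λ j eq → trans (^ᶻ-suc′ j) (trans (cong (b ^ᶻ i ℚ.*_) eq) (sym (rhs j))))
    (λ j eq → *-cancelˡ-≡ (b ^ᶻ i) (trans (sym (^ᶻ-suc′ j)) (trans eq (rhs j)))) j
    where
    ^ᶻ-suc′ : ∀ j → (b ^ᶻ i) ^ᶻ ℤ.suc j ≡ b ^ᶻ i ℚ.* (b ^ᶻ i) ^ᶻ j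
    ^ᶻ-suc′ = ^ᶻ-suc (b ^ᶻ i)

    rhs : ∀ j → b ^ᶻ (i ℤ.* ℤ.suc j) ≡ b ^ᶻ i ℚ.* b ^ᶻ (i ℤ.* j)
    rhs j = trans (cong (b ^ᶻ_) (ℤₚ.*-suc i j)) (^ᶻ-homo-+ b i (i ℤ.* j))

-- Powers of 3

3ℚ : ℚ
3ℚ = + 3 ℚ./ 1

3^ᶻ-pos : ∀ i → ℚ.Positive (3ℚ ^ᶻ i)
3^ᶻ-pos (+ zero)     = _
3^ᶻ-pos (+ suc n)    = ℚₚ.pos*pos⇒pos 3ℚ (3ℚ ^ n) {{3^ᶻ-pos (+ n)}}
3^ᶻ-pos -[1+ zero ]  = _
3^ᶻ-pos -[1+ suc n ] = ℚₚ.pos*pos⇒pos (1/ 3ℚ) ((1/ 3ℚ) ^ suc n) {{3^ᶻ-pos -[1+ n ]}}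

3^ᶻ-nonZero : ∀ i → ℚ.NonZero (3ℚ ^ᶻ i)
3^ᶻ-nonZero i = ℚₚ.pos⇒nonZero (3ℚ ^ᶻ i) {{3^ᶻ-pos i}}

3^ᶻ-mono-< : ∀ {i j} → i ℤ.< j → 3ℚ ^ᶻ i ℚ.< 3ℚ ^ᶻ j
3^ᶻ-mono-< {i} {j} i<j =
  subst (λ k → 3ℚ ^ᶻ i ℚ.< 3ℚ ^ᶻ k) (suc-i+[j-suc-i]≡j i j)
    (go (j ℤ.- ℤ.suc i) (ℤₚ.i≤j⇒0≤j-i (ℤₚ.i<j⇒suc[i]≤j i<j)))
  where
  suc-i+[j-suc-i]≡j : ∀ i j → 1ℤ ℤ.+ i ℤ.+ (j ℤ.- (1ℤ ℤ.+ i)) ≡ j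
  suc-i+[j-suc-i]≡j = solve-∀

  assoc : ∀ i k → 1ℤ ℤ.+ (i ℤ.+ k) ≡ i ℤ.+ (1ℤ ℤ.+ k)
  assoc = solve-∀

  step : ∀ i → 3ℚ ^ᶻ i ℚ.< 3ℚ ^ᶻ ℤ.suc i
  step i = subst₂ ℚ._<_ (ℚₚ.*-identityˡ _) (sym (^ᶻ-suc 3ℚ i))
    (ℚₚ.*-monoˡ-<-pos (3ℚ ^ᶻ i) {{3^ᶻ-pos i}} {1ℚ} {3ℚ} (ℚ.*<* (ℤ.+<+ (ℕ.s≤s (ℕ.s≤s ℕ.z≤n)))))

  go : ∀ k → 0ℤ ℤ.≤ k → 3ℚ ^ᶻ i ℚ.< 3ℚ ^ᶻ (ℤ.suc i ℤ.+ k)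
  go (+ zero)  _ = subst (λ k → 3ℚ ^ᶻ i ℚ.< 3ℚ ^ᶻ k) (sym (ℤₚ.+-identityʳ (ℤ.suc i))) (step i)
  go (+ suc k) _ = ℚₚ.<-trans (go (+ k) (ℤ.+≤+ ℕ.z≤n))
    (subst (λ l → 3ℚ ^ᶻ (ℤ.suc i ℤ.+ + k) ℚ.< 3ℚ ^ᶻ l) (assoc (ℤ.suc i) (+ k))
      (step (ℤ.suc i ℤ.+ + k)))

3^ᶻ-cancel-< : ∀ {i j} → 3ℚ ^ᶻ i ℚ.< 3ℚ ^ᶻ j → i ℤ.< j
3^ᶻ-cancel-< {i} {j} 3^i<3^j with ℤₚ.<-cmp i j
... | tri< i<j _ _  = i<j
... | tri≈ _ refl _ = contradiction 3^i<3^j (ℚₚ.<-irrefl refl)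
... | tri> _ _ j<i  = contradiction 3^i<3^j (ℚₚ.<-asym (3^ᶻ-mono-< j<i))

module _ (N d : ℤ) .{{_ : ℚ.NonZero (3ℚ ^ᶻ d)}} (r : ℚ) where

  -- Both sides of the inequality, raised to the denominator of r, are powers of 3, and it remains
  -- to compare their exponents.
  <^-ℚ⇒<ℤ : (3ℚ ^ᶻ N) < (3ℚ ^ᶻ d) ^-ℚ r → N ℤ.* ↧ r ℤ.< d ℤ.* ℤ.- ↥ r
  <^-ℚ⇒<ℤ lt = 3^ᶻ-cancel-< (subst₂ ℚ._<_
    (^ᶻ-* 3ℚ N {{3^ᶻ-nonZero N}} (↧ r)) (^ᶻ-* 3ℚ d (ℤ.- ↥ r)) lt)

  <ℤ⇒<^-ℚ : N ℤ.* ↧ r ℤ.< d ℤ.* ℤ.- ↥ r → (3ℚ ^ᶻ N) < (3ℚ ^ᶻ d) ^-ℚ r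
  <ℤ⇒<^-ℚ lt = subst₂ ℚ._<_
    (sym (^ᶻ-* 3ℚ N {{3^ᶻ-nonZero N}} (↧ r))) (sym (^ᶻ-* 3ℚ d (ℤ.- ↥ r))) (3^ᶻ-mono-< lt)

-- Lacunary series

1𝕂-coeff : ∀ i → i ≢ 0ℤ → coeff 1𝕂 i ≡ 0F
1𝕂-coeff (+ zero)  i≢0 = contradiction refl i≢0
1𝕂-coeff (+ suc _) _   = refl
1𝕂-coeff -[1+ _ ]  _   = refl

X^ : ℕ → 𝔽₃[X]
X^ zero    = 1F ∷ []
X^ (suc n) = 0F ∷ X^ n

X^-·-coeff : ∀ n x i → coeff (X^ n · x) i ≡ coeff x (i ℤ.- + n)
X^-·-coeff zero    x i = trans (+₃-identityʳ _) (trans (1*a (coeff x i))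
  (cong (coeff x) (sym (ℤₚ.+-identityʳ i))))
  where
  1*a : ∀ a → 1F *₃ a ≡ a
  1*a 0F = refl
  1*a 1F = refl
  1*a 2F = refl
X^-·-coeff (suc n) x i = trans (+₃-identityˡ _) (trans (X^-·-coeff n x (ℤ.pred i))
  (cong (coeff x) (lemma i (+ n))))
  where
  lemma : ∀ i n → ℤ.-1ℤ ℤ.+ i ℤ.- n ≡ i ℤ.- (1ℤ ℤ.+ n)
  lemma = solve-∀

∣X^∣ : ∀ n → ∣ ι (X^ n) ∣≐ (3ℚ ^ᶻ + n)
∣X^∣ n = inj₂ (+ n
  , (λ c≡0 → contradiction (trans (sym top) c≡0) λ ())
  , (λ i n<i → trans (X^-·-coeff n 1𝕂 i) (1𝕂-coeff _ λ i-n≡0 →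
      ℤₚ.<-irrefl (sym (ℤₚ.i-j≡0⇒i≡j i (+ n) i-n≡0)) n<i))
  , refl)
  where
  top : coeff (ι (X^ n)) (+ n) ≡ 1F
  top = trans (X^-·-coeff n 1𝕂 (+ n)) (cong (coeff 1𝕂) (ℤₚ.i≡j⇒i-j≡0 {+ n} refl))

ι-applyUpTo : ∀ f m → (∀ i → m ≤ i → f i ≡ 0F) → ∀ i → coeff (ι (applyUpTo f m)) (+ i) ≡ f i
ι-applyUpTo f zero    f≡0 i       = sym (f≡0 i ℕ.z≤n)
ι-applyUpTo f (suc m) f≡0 zero    = ι-head (f 0) (applyUpTo (f ∘ suc) m)
ι-applyUpTo f (suc m) f≡0 (suc i) = trans (ι-tail (f 0) (applyUpTo (f ∘ suc) m) i)
  (ι-applyUpTo (f ∘ suc) m (λ i m≤i → f≡0 (suc i) (ℕ.s≤s m≤i)) i)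

-- The series ξ = 2 Σ X^(-n j) is over j ≥ 1: there is no term for n 0 = 0.
module Lacunary
  (n : ℕ → ℕ) (n₀ : n 0 ≡ 0) (double : ∀ j → n j + n j ≤ n (suc j))
  (n-step : ∀ j → n j < n (suc j))
  where

  n-mono : ∀ {j l} → j ≤ l → n j ≤ n l
  n-mono {zero} {l} _ = subst (_≤ n l) (sym n₀) ℕ.z≤n
  n-mono {suc j} {suc l} (ℕ.s≤s j≤l) with ℕₚ.m≤n⇒m<n∨m≡n j≤l
  ... | inj₁ j<l  = ℕₚ.≤-trans (n-mono j<l) (ℕₚ.<⇒≤ (n-step l))
  ... | inj₂ refl = ℕₚ.≤-refl

  j≤n : ∀ j → j ≤ n j
  j≤n zero    = ℕ.z≤n
  j≤n (suc j) = ℕₚ.≤-<-trans (j≤n j) (n-step j)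

  pos : ℕ → ℤ
  pos j = ℤ.- + n j

  pos-anti : ∀ {j l} → j ≤ l → pos l ℤ.≤ pos j
  pos-anti j≤l = ℤₚ.neg-mono-≤ (ℤ.+≤+ (n-mono j≤l))

  pos-step : ∀ j → pos (suc j) ℤ.< pos j
  pos-step j = ℤₚ.neg-mono-< (ℤ.+<+ (n-step j))

  term : ℕ → 𝕂
  term j = 2F ∙ shift (n j) 1𝕂

  part : ℕ → 𝕂
  part zero    = 0𝕂
  part (suc j) = part j +ᴷ term (suc j)

  term-zero : ∀ j i → i ≢ pos j → coeff (term j) i ≡ 0F
  term-zero j i i≢pos = cong (2F *₃_) (1𝕂-coeff (+ n j ℤ.+ i) λ n+i≡0 →
    i≢pos (trans (move (+ n j) i) (trans (cong (ℤ._- + n j) n+i≡0) (ℤₚ.+-identityˡ _))))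
    where
    move : ∀ n i → i ≡ n ℤ.+ i ℤ.- n
    move = solve-∀

  term-pos : ∀ j → coeff (term j) (pos j) ≡ 2F
  term-pos j = cong (λ i → 2F *₃ coeff 1𝕂 i) (ℤₚ.+-inverseʳ (+ n j))

  part-suc : ∀ j i → i ≢ pos (suc j) → coeff (part (suc j)) i ≡ coeff (part j) i
  part-suc j i i≢pos = trans (cong (coeff (part j) i +₃_) (term-zero (suc j) i i≢pos)) (+₃-identityʳ _)

  part-below : ∀ j i → i ℤ.< pos j → coeff (part j) i ≡ 0F
  part-below zero    i _     = refl
  part-below (suc j) i i<pos = trans (part-suc j i (ℤₚ.<⇒≢ i<pos))
    (part-below j i (ℤₚ.<-trans i<pos (pos-step j)))

  part-nonneg : ∀ j m → coeff (part j) (+ m) ≡ 0F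
  part-nonneg zero    m = refl
  part-nonneg (suc j) m = trans (part-suc j (+ m) λ m≡pos →
    ℤₚ.<⇒≱ (ℤₚ.neg-mono-< (ℤ.+<+ (ℕₚ.≤-<-trans ℕ.z≤n (n-step j))))
      (subst (0ℤ ℤ.≤_) m≡pos (ℤ.+≤+ ℕ.z≤n)))
    (part-nonneg j m)

  -- All terms after the j-th sit at or below `pos (suc j)`.
  part-stable : ∀ {j l} → j ≤ l → ∀ i → pos (suc j) ℤ.< i → coeff (part l) i ≡ coeff (part j) i
  part-stable {l = zero}  ℕ.z≤n i pos<i = refl
  part-stable {j} {suc l} j≤sl  i pos<i with ℕₚ.m≤n⇒m<n∨m≡n j≤sl
  ... | inj₁ j<sl = let j≤l = ℕ.s≤s⁻¹ j<sl in
    trans (part-suc l i (ℤₚ.<⇒≢ (ℤₚ.≤-<-trans (pos-anti (ℕ.s≤s j≤l)) pos<i) ∘ sym))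
      (part-stable j≤l i pos<i)
  ... | inj₂ refl = refl

  part-new : ∀ j → coeff (part (suc j)) (pos (suc j)) ≡ 2F
  part-new j = cong₂ _+₃_ (part-below j _ (pos-step j)) (term-pos (suc j))

  part-digit : ∀ j i → coeff (part j) i ≡ 0F ⊎ coeff (part j) i ≡ 2F
  part-digit zero    i = inj₁ refl
  part-digit (suc j) i with i ℤₚ.≟ pos (suc j)
  ... | yes refl  = inj₂ (part-new j)
  ... | no i≢pos with part-digit j i
  ...   | inj₁ ≡0 = inj₁ (trans (part-suc j i i≢pos) ≡0)
  ...   | inj₂ ≡2 = inj₂ (trans (part-suc j i i≢pos) ≡2)

  -- The digit at X^i is read off the partial sum with index |i|, which is final there because j ≤ n
  -- j.
  ξ : 𝕂
  ξ = record
    { coeff   = λ i → coeff (part ℤ.∣ i ∣) i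
    ; bound   = 0ℤ
    ; bounded = λ { (+ m) _ → part-nonneg m m }
    }

  ξ-cantor : Cantor ξ
  ξ-cantor = (λ { (+ m) _ → part-nonneg m m }) , (λ i _ → part-digit ℤ.∣ i ∣ i)

  ξ-part : ∀ j i → pos (suc j) ℤ.< i → coeff ξ i ≡ coeff (part j) i
  ξ-part j i pos<i with ℕₚ.≤-total j ℤ.∣ i ∣
  ... | inj₁ j≤∣i∣ = part-stable j≤∣i∣ i pos<i
  ... | inj₂ ∣i∣≤j = sym (part-stable ∣i∣≤j i (pos∣i∣<i i))
    where
    pos∣i∣<i : ∀ i → pos (suc ℤ.∣ i ∣) ℤ.< i
    pos∣i∣<i (+ m)    = ℤₚ.<-≤-trans (pos-step m) (ℤₚ.≤-trans (pos-anti {0} {m} ℕ.z≤n)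
      (ℤₚ.≤-trans (ℤₚ.≤-reflexive (cong (λ n → ℤ.- + n) n₀)) (ℤ.+≤+ ℕ.z≤n)))
    pos∣i∣<i -[1+ m ] = ℤₚ.neg-mono-< (ℤ.+<+ (j≤n (suc (suc m))))

  part-old : ∀ {j l} → j < l → coeff (part l) (pos (suc j)) ≡ 2F
  part-old {j} j<l = trans (part-stable j<l _ (pos-step (suc j))) (part-new j)

  ξ-pos : ∀ j → coeff ξ (pos (suc j)) ≡ 2F
  ξ-pos j = trans (ξ-part (suc j) _ (pos-step (suc j))) (part-new j)

  ξ-gap : ∀ j m → n j < m → m < n (suc j) → coeff ξ (ℤ.- + m) ≡ 0F
  ξ-gap j m n<m m<N = trans (ξ-part j _ (ℤₚ.neg-mono-< (ℤ.+<+ m<N)))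
    (part-below j _ (ℤₚ.neg-mono-< (ℤ.+<+ n<m)))

  ξ-part-vanishesAbove : ∀ j → VanishesAbove (pos (suc j)) (ξ -ᴷ part j)
  ξ-part-vanishesAbove j i pos<i = x≡y⇒x-y≡0 ξ (part j) i (ξ-part j i pos<i)

  ∣ξ-part∣ : ∀ j → ∣ ξ -ᴷ part j ∣≐ (3ℚ ^ᶻ pos (suc j))
  ∣ξ-part∣ j = inj₂ (pos (suc j)
    , (λ c≡0 → contradiction (trans (sym (cong₂ (λ a b → a +₃ -₃ b)
        (ξ-pos j) (part-below j _ (pos-step j)))) c≡0) λ ())
    , ξ-part-vanishesAbove j
    , refl)

  -- The product of X^(n j) and `part j`, which has degree less than n j.
  numerator : ℕ → 𝔽₃[X]
  numerator j = applyUpTo (λ i → coeff (part j) (+ i ℤ.- + n j)) (n j)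

  part-isQuotient : ∀ j → part j IsQuotient numerator j / X^ (n j)
  part-isQuotient j = record
    { h≉0   = λ X^≈0 → contradiction (trans (sym (X^-·-coeff (n j) 1𝕂 (+ n j))) (X^≈0 (+ n j)))
        (subst (λ i → coeff 1𝕂 i ≢ 0F) (sym (ℤₚ.i≡j⇒i-j≡0 {+ n j} refl)) λ ())
    ; h·x≈g = λ i → trans (X^-·-coeff (n j) (part j) i) (digits i)
    }
    where
    digits : ∀ i → coeff (part j) (i ℤ.- + n j) ≡ coeff (ι (numerator j)) i
    digits (+ i)    = sym (ι-applyUpTo _ (n j)
      (λ i n≤i → trans (cong (coeff (part j)) (trans (ℤₚ.m-n≡m⊖n i (n j)) (ℤₚ.⊖-≥ n≤i)))
        (part-nonneg j _)) i)
    digits -[1+ i ] = trans (part-below j _ (subst (-[1+ i ] ℤ.- + n j ℤ.<_) (ℤₚ.+-identityˡ _)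
      (ℤₚ.+-monoˡ-< (ℤ.- + n j) ℤ.-<+))) (sym (ι-neg (numerator j) i))

  -- The inequality q < n (suc j) / n j, multiplied out because n 0 = 0.
  Exceeds : ℕ → ℚ → Set
  Exceeds j q = + n j ℤ.* ↥ q ℤ.< + n (suc j) ℤ.* ↧ q

  Exceeds-lower : ∀ j {r s} → r ℚ.< s → Exceeds j s → Exceeds j r
  Exceeds-lower j {r} {s} (ℚ.*<* r<s) ns<N = ℤₚ.*-cancelʳ-<-nonNeg (↧ s) (begin-strict
    + n j ℤ.* ↥ r ℤ.* ↧ s          ≡⟨ ℤₚ.*-assoc (+ n j) (↥ r) (↧ s) ⟩
    + n j ℤ.* (↥ r ℤ.* ↧ s)        ≤⟨ ℤₚ.*-monoˡ-≤-nonNeg (+ n j) (ℤₚ.<⇒≤ r<s) ⟩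
    + n j ℤ.* (↥ s ℤ.* ↧ r)        ≡⟨ ℤₚ.*-assoc (+ n j) (↥ s) (↧ r) ⟨
    + n j ℤ.* ↥ s ℤ.* ↧ r          <⟨ ℤₚ.*-monoʳ-<-pos (↧ r) ns<N ⟩
    + n (suc j) ℤ.* ↧ s ℤ.* ↧ r    ≡⟨ swap (+ n (suc j)) (↧ s) (↧ r) ⟩
    + n (suc j) ℤ.* ↧ r ℤ.* ↧ s    ∎)
    where
    open ℤₚ.≤-Reasoning
    swap : ∀ a b c → a ℤ.* b ℤ.* c ≡ a ℤ.* c ℤ.* b
    swap = solve-∀

  part-approximates : ∀ j {q s} → q ℚ.< s → Exceeds j s → Approximates ξ (fromℚ q) (part j)
  part-approximates j {q} {s} q<s exceeds = record
    { g = numerator j ; h = X^ (n j)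
    ; x≐g/h = part-isQuotient j
    ; ∣ξ-x∣ = 3ℚ ^ᶻ pos (suc j) ; ∣h∣ = 3ℚ ^ᶻ + n j
    ; ∣ξ-x∣-abs = ∣ξ-part∣ j
    ; ∣h∣-abs = ∣X^∣ (n j)
    ; ∣h∣≢0 = 3^ᶻ-nonZero (+ n j)
    -- The upper end s carries the estimate. Any r below q serves as the lower end, by
    -- `Exceeds-lower`.
    ; inequality = r , s , r<q , q<s
      , small r (Exceeds-lower j (ℚₚ.<-trans r<q q<s) exceeds) , small s exceeds
    }
    where
    r = proj₁ (ℝ.L-inhab (fromℚ q))
    r<q = proj₂ (ℝ.L-inhab (fromℚ q))

    instance
      ∣h∣≢0 : ℚ.NonZero (3ℚ ^ᶻ + n j)
      ∣h∣≢0 = 3^ᶻ-nonZero (+ n j)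

    small : ∀ r → Exceeds j r → (3ℚ ^ᶻ pos (suc j)) < (3ℚ ^ᶻ + n j) ^-ℚ r
    small r nr<N = <ℤ⇒<^-ℚ (pos (suc j)) (+ n j) r
      (subst₂ ℤ._<_ (ℤₚ.neg-distribˡ-* (+ n (suc j)) (↧ r)) (ℤₚ.neg-distribʳ-* (+ n j) (↥ r))
        (ℤₚ.neg-mono-< nr<N))

  open Membership 𝕂-setoid using (_∉_)

  -- At the index of the (suc j)-th term, part j has digit 0 and all later
  -- partial sums have digit 2.
  part-∉ : ∀ xs J → ∃[ j ] (J ≤ j × part j ∉ xs)
  part-∉ []       J = J , ℕₚ.≤-refl , λ ()
  part-∉ (y ∷ xs) J with part-∉ xs J
  ... | j , J≤j , j∉xs with coeff y (pos (suc j)) Finₚ.≟ 0F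
  ...   | no y≢0 = j , J≤j , λ
    { (here p≈y)   → y≢0 (trans (sym (p≈y _)) (part-below j _ (pos-step j)))
    ; (there p∈xs) → j∉xs p∈xs }
  ...   | yes y≡0 with part-∉ xs (suc j)
  ...     | l , j<l , l∉xs = l , ℕₚ.≤-trans J≤j (ℕₚ.<⇒≤ j<l) , λ
    { (here p≈y)   → contradiction (trans (sym (part-old j<l)) (trans (p≈y _) y≡0)) λ ()
    ; (there p∈xs) → l∉xs p∈xs }

  infinite-approximations : ∀ {q s} → q ℚ.< s → ∃[ J ] (∀ j → J ≤ j → Exceeds j s) →
    Infinite 𝕂-setoid (Approximates ξ (fromℚ q))
  infinite-approximations q<s (J , exceeds) xs =
    let j , J≤j , part∉xs = part-∉ xs J
    in part j , part-approximates j q<s (exceeds j J≤j) , part∉xs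

-- Finiteness of good approximations

module _ {c ℓ} (S : Setoid c ℓ) where

  open Setoid S renaming (_≈_ to _≈ₛ_)

  -- Induction on the list of codes. Up to equality only one element has code c, so of an x outside
  -- xs and a y outside x ∷ xs one has its code among the rest; hence the elements coded by the rest
  -- are still infinitely many.
  finitely-coded⇒¬infinite : ∀ {k r p} {Code : Set k} (R : Carrier → Code → Set r) →
    (∀ {x y c} → R x c → R y c → x ≈ₛ y) →
    (cs : List Code) (P : Pred Carrier p) → (∀ x → P x → Any (R x) cs) → ¬ Infinite S P
  finitely-coded⇒¬infinite R unique []       P coded infinite with infinite []
  ... | x , Px , _ with coded x Px
  ...   | ()
  finitely-coded⇒¬infinite R unique (c ∷ cs) P coded infinite =
    finitely-coded⇒¬infinite R unique cs (λ x → P x × Any (R x) cs) (λ _ → proj₂) infinite′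
    where
    infinite′ : Infinite S (λ x → P x × Any (R x) cs)
    infinite′ xs with infinite xs
    ... | x , Px , x∉xs with coded x Px
    ...   | there Rx = x , (Px , Rx) , x∉xs
    ...   | here Rxc with infinite (x ∷ xs)
    ...     | y , Py , y∉x∷xs with coded y Py
    ...       | there Ry = y , (Py , Ry) , (y∉x∷xs ∘ there)
    ...       | here Ryc = contradiction (here (unique Ryc Rxc)) y∉x∷xs

-- Polynomials of bounded degree

words : ℕ → List 𝔽₃[X]
words zero    = [] ∷ []
words (suc n) = cartesianProductWith _∷_ (allFin 3) (words n)

-- A list of any length may represent a polynomial of degree below D, so w is only asked to act on
-- every series as p does.
words-complete : ∀ D p → (∀ n → D ≤ n → coeff (ι p) (+ n) ≡ 0F) →
  ∃[ w ] (w ∈ words D × (∀ x → p · x ≈ w · x))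
words-complete zero    p       p≡0 = [] , here refl , λ x → ·-zero p x (λ n → p≡0 n ℕ.z≤n)
words-complete (suc D) []      p≡0 =
  let w , w∈ , []≈w = words-complete D [] (λ _ _ → refl)
  in 0F ∷ w , ∈-cartesianProductWith⁺ _∷_ (∈-allFin 0F) w∈
   , λ x i → trans ([]≈w x (ℤ.pred i)) (sym (+₃-identityˡ _))
words-complete (suc D) (a ∷ p) p≡0 =
  let w , w∈ , p≈w = words-complete D p
        (λ n D≤n → trans (sym (ι-tail a p n)) (p≡0 (suc n) (ℕ.s≤s D≤n)))
  in a ∷ w , ∈-cartesianProductWith⁺ _∷_ (∈-allFin a) w∈
   , λ x i → cong (a *₃ coeff x i +₃_) (p≈w x (ℤ.pred i))

HasDegree : 𝔽₃[X] → ℕ → Set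
HasDegree p d = coeff (ι p) (+ d) ≢ 0F × (∀ n → d < n → coeff (ι p) (+ n) ≡ 0F)

HasDegree-unique : ∀ p {d e} → HasDegree p d → HasDegree p e → d ≡ e
HasDegree-unique p {d} {e} (pd≢0 , p≡0) (pe≢0 , p≡0′) with ℕₚ.<-cmp d e
... | tri< d<e _ _ = contradiction (p≡0 e d<e) pe≢0
... | tri≈ _ d≡e _ = d≡e
... | tri> _ _ e<d = contradiction (p≡0′ d e<d) pd≢0

·-𝕂0 : ∀ p → p · 0𝕂 ≈ 0𝕂
·-𝕂0 []      i = refl
·-𝕂0 (a ∷ p) i = cong₂ _+₃_ (*₃-zeroʳ a) (·-𝕂0 p (ℤ.pred i))

·-nonzero⇒≤ : ∀ p d x M i → (∀ n → d < n → coeff (ι p) (+ n) ≡ 0F) →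
  VanishesAbove M x → coeff (p · x) i ≢ 0F → i ℤ.≤ M ℤ.+ + d
·-nonzero⇒≤ p d x M i p≡0 x≡0 px≢0 = ℤₚ.≮⇒≥ (px≢0 ∘ ·-vanishesAbove p d x M p≡0 x≡0 i)

∣ι∣⇒degree : ∀ p {a} → ¬ (ι p ≈ 0𝕂) → ∣ ι p ∣≐ a →
  ∃[ d ] (HasDegree p d × a ≡ 3ℚ ^ᶻ + d)
∣ι∣⇒degree p p≉0 (inj₁ (p≈0 , _)) = contradiction p≈0 p≉0
∣ι∣⇒degree p p≉0 (inj₂ (+ d , pd≢0 , p≡0 , a≡)) =
  d , (pd≢0 , λ n d<n → p≡0 (+ n) (ℤ.+<+ d<n)) , a≡
∣ι∣⇒degree p p≉0 (inj₂ (-[1+ d ] , pd≢0 , _)) = contradiction (ι-neg p d) pd≢0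

L<U : ∀ x {p q} → L x p → U x q → p ℚ.< q
L<U x {p} {q} Lp Uq with ℚₚ.<-cmp p q
... | tri< p<q _ _  = p<q
... | tri≈ _ refl _ = contradiction (Lp , Uq) (ℝ.disjoint x)
... | tri> _ _ q<p  = contradiction (ℝ.L-lower x q<p Lp , Uq) (ℝ.disjoint x)

-- The inequality at the end s above t passes down to q < s because d ≥ 0. It bounds N times the
-- denominator of q strictly by -d a ≤ 0, which makes N negative.
<^-ℝ⇒< : ∀ {x y N d} .{{_ : ℚ.NonZero y}} t q {a} → L t q → ↥ q ≡ + a →
  x ≡ 3ℚ ^ᶻ N → y ≡ 3ℚ ^ᶻ + d → x < y ^-ℝ t →
  ∃[ e ] (N ≡ -[1+ e ] × d * a < suc e * ↧ₙ q)
<^-ℝ⇒< {N = N} {d} t q {a} Lq ↥q≡a refl refl (_ , s , _ , Us , _ , small) = negative N N<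
  where
  open ℤₚ.≤-Reasoning
  q<s = ℚₚ.drop-*<* (L<U t Lq Us)

  swap : ∀ a b c → a ℤ.* b ℤ.* c ≡ a ℤ.* c ℤ.* b
  swap = solve-∀

  rearrange : ∀ a b c → a ℤ.* ℤ.- b ℤ.* c ≡ a ℤ.* ℤ.- (b ℤ.* c)
  rearrange = solve-∀

  N< : N ℤ.* ↧ q ℤ.< + d ℤ.* ℤ.- + a
  N< = subst (λ z → N ℤ.* ↧ q ℤ.< + d ℤ.* ℤ.- z) ↥q≡a (ℤₚ.*-cancelʳ-<-nonNeg (↧ s) (begin-strict
    N ℤ.* ↧ q ℤ.* ↧ s              ≡⟨ swap N (↧ q) (↧ s) ⟩
    N ℤ.* ↧ s ℤ.* ↧ q              <⟨ ℤₚ.*-monoʳ-<-pos (↧ q) (<^-ℚ⇒<ℤ N (+ d) s small) ⟩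
    + d ℤ.* ℤ.- ↥ s ℤ.* ↧ q        ≡⟨ rearrange (+ d) (↥ s) (↧ q) ⟩
    + d ℤ.* ℤ.- (↥ s ℤ.* ↧ q)      ≤⟨ ℤₚ.*-monoˡ-≤-nonNeg (+ d) (ℤₚ.neg-mono-≤ (ℤₚ.<⇒≤ q<s)) ⟩
    + d ℤ.* ℤ.- (↥ q ℤ.* ↧ s)      ≡⟨ rearrange (+ d) (↥ q) (↧ s) ⟨
    + d ℤ.* ℤ.- ↥ q ℤ.* ↧ s        ∎))

  negative : ∀ N → N ℤ.* ↧ q ℤ.< + d ℤ.* ℤ.- + a → ∃[ e ] (N ≡ -[1+ e ] × d * a < suc e * ↧ₙ q)
  negative (+ m) m*c< = contradiction m*c< (ℤₚ.≤⇒≯ (begin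
    + d ℤ.* ℤ.- + a      ≡⟨ ℤₚ.neg-distribʳ-* (+ d) (+ a) ⟨
    ℤ.- (+ d ℤ.* + a)    ≡⟨ cong ℤ.-_ (ℤₚ.pos-* d a) ⟨
    ℤ.- + (d * a)        ≤⟨ ℤₚ.neg-≤-pos {d * a} {m * ↧ₙ q} ⟩
    + (m * ↧ₙ q)         ≡⟨ ℤₚ.pos-* m (↧ₙ q) ⟩
    + m ℤ.* ↧ q          ∎))
  negative -[1+ e ] e*c< = e , refl , ℤₚ.drop‿+<+ (ℤₚ.neg-cancel-< (begin-strict
    ℤ.- + (suc e * ↧ₙ q)       ≡⟨ cong ℤ.-_ (ℤₚ.pos-* (suc e) (↧ₙ q)) ⟩
    ℤ.- (+ suc e ℤ.* ↧ q)      ≡⟨ ℤₚ.neg-distribˡ-* (+ suc e) (↧ q) ⟩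
    -[1+ e ] ℤ.* ↧ q           <⟨ e*c< ⟩
    + d ℤ.* ℤ.- + a            ≡⟨ ℤₚ.neg-distribʳ-* (+ d) (+ a) ⟨
    ℤ.- (+ d ℤ.* + a)          ≡⟨ cong ℤ.-_ (ℤₚ.pos-* d a) ⟨
    ℤ.- + (d * a)              ∎))

-- Upper bound for the irrationality exponent

module LacunaryBound
  (n : ℕ → ℕ) (n₀ : n 0 ≡ 0) (double : ∀ j → n j + n j ≤ n (suc j))
  (n-step : ∀ j → n j < n (suc j))
  (u v J : ℕ) .{{_ : ℕ.NonZero v}} (2v≤u : v + v ≤ u)
  (ratio : ∀ j → J ≤ j → n (suc j) * v ≤ n j * u)
  where

  open Lacunary n n₀ double n-step

  -- From J on the gap n (suc j) - 2 n j is at most n j (u/v - 2), which gives the quotient; the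
  -- summand n J covers the j below J.
  G : ℕ → ℕ
  G d = (d * (u ∸ (v + v))) ℕ./ v + n J

  G-mono : ∀ {d e} → d ≤ e → G d ≤ G e
  G-mono d≤e = ℕₚ.+-monoˡ-≤ (n J) (ℕ./-monoˡ-≤ v (ℕₚ.*-monoˡ-≤ (u ∸ (v + v)) d≤e))

  gap : ∀ j → n (suc j) ≤ n j + n j + G (n j)
  gap j with J ℕₚ.≤? j
  ... | yes J≤j = begin
    n (suc j)                                    ≤⟨ ℕₚ.m≤n+m∸n (n (suc j)) (n j + n j) ⟩
    n j + n j + (n (suc j) ∸ (n j + n j))        ≤⟨ ℕₚ.+-monoʳ-≤ (n j + n j) (begin
      n (suc j) ∸ (n j + n j)                      ≡⟨ ℕ.m*n/n≡m _ v ⟨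
      (n (suc j) ∸ (n j + n j)) * v ℕ./ v          ≤⟨ ℕ./-monoˡ-≤ v (begin
        (n (suc j) ∸ (n j + n j)) * v                ≡⟨ ℕₚ.*-distribʳ-∸ v (n (suc j)) (n j + n j) ⟩
        n (suc j) * v ∸ (n j + n j) * v              ≤⟨ ℕₚ.∸-monoˡ-≤ ((n j + n j) * v) (ratio j J≤j) ⟩
        n j * u ∸ (n j + n j) * v                    ≡⟨ cong (n j * u ∸_) (double-* (n j) v) ⟩
        n j * u ∸ n j * (v + v)                      ≡⟨ ℕₚ.*-distribˡ-∸ (n j) u (v + v) ⟨
        n j * (u ∸ (v + v))                          ∎) ⟩
      n j * (u ∸ (v + v)) ℕ./ v                    ≤⟨ ℕₚ.m≤m+n _ (n J) ⟩
      G (n j)                                      ∎) ⟩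
    n j + n j + G (n j)                          ∎
    where
    open ℕₚ.≤-Reasoning
    double-* : ∀ n v → (n + n) * v ≡ n * (v + v)
    double-* = ℕ-Solver.solve-∀
  ... | no J≰j = ℕₚ.≤-trans (n-mono (ℕₚ.≰⇒> J≰j))
    (ℕₚ.≤-trans (ℕₚ.m≤n+m (n J) _) (ℕₚ.m≤n+m (G (n j)) (n j + n j)))

  -- When d < n j, the terms after the j-th do not reach the digits of p · ξ that
  -- are found in p · part j.
  ξ-small-index : ∀ p d → HasDegree p d →
    ∃[ k ] (coeff (p · ξ) -[1+ k ] ≢ 0F × suc k ≤ d + G d)
  -- The choice j = d + 1 is large enough, since j ≤ n j.
  ξ-small-index p d (pd≢0 , p≡0) = found (small-index (suc d) d d<n pd≢0 (λ i d<i _ → p≡0 i d<i))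
    where
    d<n : d < n (suc d)
    d<n = j≤n (suc d)

    open Gaps n n₀ double G G-mono gap (coeff (ι p)) (ι-neg p)
      (λ j k → coeff (p · part j) (ℤ.- + k))
      (λ k → ·-𝕂0 p (ℤ.- + k))
      (λ j k → trans (·-distribˡ-+ᴷ p (part j) (term (suc j)) (ℤ.- + k))
        (cong (coeff (p · part j) (ℤ.- + k) +₃_)
          (trans (·-∙-comm p 2F (shift (n (suc j)) 1𝕂) (ℤ.- + k))
            (cong (2F *₃_) (trans (·-shift p (n (suc j)) 1𝕂 (ℤ.- + k))
              (cong (coeff (ι p)) (ℤₚ.m-n≡m⊖n (n (suc j)) k)))))))
      using (small-index; SmallIndex)

    found : SmallIndex (suc d) d → ∃[ k ] (coeff (p · ξ) -[1+ k ] ≢ 0F × suc k ≤ d + G d)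
    found (suc k , _ , k≤n , b≢0 , k≤) = k
      , (λ c≡0 → b≢0 (trans (sym (a-b≡0⇒a≡b _ _ (trans (sym (·-distribˡ--ᴷ p ξ (part (suc d)) -[1+ k ]))
          (·-vanishesAbove p d (ξ -ᴷ part (suc d)) (pos (suc (suc d))) p≡0
            (ξ-part-vanishesAbove (suc d)) -[1+ k ] pos+d<-k)))) c≡0))
      , k≤
      where
      pos+d<-k : pos (suc (suc d)) ℤ.+ + d ℤ.< -[1+ k ]
      pos+d<-k = subst (pos (suc (suc d)) ℤ.+ + d ℤ.<_) (cancel (+ suc k) (+ d))
        (ℤₚ.+-monoˡ-< (+ d) (ℤₚ.neg-mono-< (ℤ.+<+
          (ℕₚ.<-≤-trans (ℕₚ.+-mono-≤-< k≤n d<n) (double (suc d))))))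
        where
        cancel : ∀ k d → ℤ.- (k ℤ.+ d) ℤ.+ d ≡ ℤ.- k
        cancel = solve-∀
    found (zero , () , _)

  -- Since h x = g has no negative powers, h (ξ - x) keeps the nonzero digit of h ξ at some index K
  -- ≤ d + G d. Hence |ξ - x| ≥ 3^(-d-K), against the upper bound that t imposes.
  approximation-degree : ∀ t q a → L t q → ↥ q ≡ + a → ∀ x → (A : Approximates ξ t x) →
    let open Approximates A in
    ∃[ d ] ∃[ e ] (HasDegree h d × VanishesAbove -[1+ e ] (ξ -ᴷ x)
      × d * a < suc e * ↧ₙ q × suc e ≤ d + (d + G d))
  approximation-degree t q a Lq ↥q≡a x A =
    let d , deg , ∣h∣≡ = ∣ι∣⇒degree h h≉0 ∣h∣-abs
        k , hξ≢0 , k≤ = ξ-small-index h d deg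
        h[ξ-x]≢0 : coeff (h · (ξ -ᴷ x)) -[1+ k ] ≢ 0F
        h[ξ-x]≢0 ≡0 = hξ≢0 (trans (a-b≡0⇒a≡b _ _ (trans (sym (·-distribˡ--ᴷ h ξ x -[1+ k ])) ≡0))
          (trans (h·x≈g -[1+ k ]) (ι-neg g k)))
    in cases d deg ∣h∣≡ k k≤ h[ξ-x]≢0 ∣ξ-x∣-abs
    where
    open Approximates A
    open _IsQuotient_/_ x≐g/h

    minus-plus : ∀ i d → i ≡ i ℤ.- d ℤ.+ d
    minus-plus = solve-∀

    cases : ∀ d → HasDegree h d → ∣h∣ ≡ 3ℚ ^ᶻ + d → ∀ k → suc k ≤ d + G d →
      coeff (h · (ξ -ᴷ x)) -[1+ k ] ≢ 0F → ∣ ξ -ᴷ x ∣≐ ∣ξ-x∣ →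
      ∃[ d ] ∃[ e ] (HasDegree h d × VanishesAbove -[1+ e ] (ξ -ᴷ x)
        × d * a < suc e * ↧ₙ q × suc e ≤ d + (d + G d))
    -- If ξ = x the difference vanishes above every M; this M puts M + d just below the nonzero
    -- digit.
    cases d deg ∣h∣≡ k k≤ ≢0 (inj₁ (ξ-x≈0 , _)) = contradiction
      (·-nonzero⇒≤ h d (ξ -ᴷ x) (ℤ.pred -[1+ k ] ℤ.- + d) -[1+ k ] (proj₂ deg) (λ i _ → ξ-x≈0 i) ≢0)
      (ℤₚ.<⇒≱ (subst (ℤ._< -[1+ k ]) (minus-plus (ℤ.pred -[1+ k ]) (+ d)) (ℤ.-<- (ℕₚ.n<1+n k))))
    cases d deg ∣h∣≡ k k≤ ≢0 (inj₂ (N , _ , vanish , ∣ξ-x∣≡))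
      with <^-ℝ⇒< {N = N} {d = d} t q Lq ↥q≡a ∣ξ-x∣≡ ∣h∣≡ inequality
    ... | e , refl , d*a< = d , e , deg , vanish , d*a< , (begin
      suc e           ≤⟨ ℤₚ.drop‿+≤+ (subst₂ ℤ._≤_
        (cancelʳ (+ suc e) (+ suc k)) (cancelˡ (+ suc e) (+ suc k) (+ d))
        (ℤₚ.+-monoʳ-≤ (+ suc e ℤ.+ + suc k)
          (·-nonzero⇒≤ h d (ξ -ᴷ x) -[1+ e ] -[1+ k ] (proj₂ deg) vanish ≢0))) ⟩
      d + suc k       ≤⟨ ℕₚ.+-monoʳ-≤ d k≤ ⟩
      d + (d + G d)   ∎)
      where
      open ℕₚ.≤-Reasoning

      cancelʳ : ∀ e k → e ℤ.+ k ℤ.+ ℤ.- k ≡ e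
      cancelʳ = solve-∀

      cancelˡ : ∀ e k d → e ℤ.+ k ℤ.+ (ℤ.- e ℤ.+ d) ≡ d ℤ.+ k
      cancelˡ = solve-∀

  -- The code is a denominator alone; the last condition, |ξ - x| < |w|⁻¹, determines the numerator.
  Coded : 𝕂 → 𝔽₃[X] → Set
  Coded x w = ∃[ d ] (HasDegree w d × (∀ k → coeff (w · x) -[1+ k ] ≡ 0F)
    × VanishesAbove -[1+ d ] (ξ -ᴷ x))

  -- Two such x differ by less than |w|⁻¹, so that the polynomial w (x − y) is zero.
  Coded-unique : ∀ {x y w} → Coded x w → Coded y w → x ≈ y
  Coded-unique {x} {y} {w} (d , deg , wx≡0 , ξ-x≡0) (d′ , deg′ , wy≡0 , ξ-y≡0)
    with HasDegree-unique w deg deg′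
  ... | refl = λ i → x-y≡0⇒x≡y x y i (·-cancel-zero w d (x -ᴷ y) (proj₁ deg) (proj₂ deg) w[x-y]≈0 i)
    where
    x-y≡0 : VanishesAbove -[1+ d ] (x -ᴷ y)
    x-y≡0 i -d<i = x≡y⇒x-y≡0 x y i
      (trans (sym (x-y≡0⇒x≡y ξ x i (ξ-x≡0 i -d<i))) (x-y≡0⇒x≡y ξ y i (ξ-y≡0 i -d<i)))

    w[x-y]≈0 : w · (x -ᴷ y) ≈ 0𝕂
    w[x-y]≈0 -[1+ k ] = trans (·-distribˡ--ᴷ w x y -[1+ k ])
      (cong₂ (λ a b → a +₃ -₃ b) (wx≡0 k) (wy≡0 k))
    w[x-y]≈0 (+ m)    = ·-vanishesAbove w d (x -ᴷ y) -[1+ d ] (proj₂ deg) x-y≡0 (+ m)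
      (subst (ℤ._< + m) (sym (-[1+d]+d≡-1 (+ d))) ℤ.-<+)
      where
      -[1+d]+d≡-1 : ∀ d → ℤ.- (1ℤ ℤ.+ d) ℤ.+ d ≡ ℤ.-1ℤ
      -[1+d]+d≡-1 = solve-∀

  finitely-many-approximations : ∀ t q a → L t q → ↥ q ≡ + a →
    ↧ₙ q + ↧ₙ q ≤ a → u * ↧ₙ q < a * v → ¬ Infinite 𝕂-setoid (Approximates ξ t)
  -- Write |ξ - x| = 3^(-K) and |h| = 3^d. Then d q < K ≤ d u/v + n J, and u/v < q bounds d, leaving
  -- finitely many denominators.
  finitely-many-approximations t q a Lq ↥q≡a 2c≤a uc<av =
    finitely-coded⇒¬infinite 𝕂-setoid Coded (λ {x} {y} {w} → Coded-unique {x} {y} {w})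
      (words D) (Approximates ξ t) coded
    where
    c = ↧ₙ q
    -- The difference q - u/v is at least 1/(v c), so d < v c n J.
    D = v * n J * c

    degree-bound : ∀ d K → d * a < K * c → K ≤ d + (d + G d) → d < D
    degree-bound d K da<Kc K≤ = ℕₚ.+-cancelˡ-< (d * u * c) d D (begin-strict
      d * u * c + d                    ≡⟨ e₁ d u c ⟩
      d * suc (u * c)                  ≤⟨ ℕₚ.*-monoʳ-≤ d uc<av ⟩
      d * (a * v)                      ≡⟨ ℕₚ.*-assoc d a v ⟨
      d * a * v                        <⟨ ℕₚ.*-monoˡ-< v da<Kc ⟩
      K * c * v                        ≤⟨ ℕₚ.*-monoˡ-≤ v (ℕₚ.*-monoˡ-≤ c K≤) ⟩
      (d + (d + (w ℕ./ v + n J))) * c * v  ≡⟨ e₂ d (w ℕ./ v) (n J) c v ⟩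
      (d * (v + v) + w ℕ./ v * v + v * n J) * c ≤⟨ ℕₚ.*-monoˡ-≤ c (ℕₚ.+-monoˡ-≤ (v * n J) (begin
        d * (v + v) + w ℕ./ v * v        ≤⟨ ℕₚ.+-monoʳ-≤ (d * (v + v)) (ℕ.m/n*n≤m w v) ⟩
        d * (v + v) + w                  ≡⟨ ℕₚ.*-distribˡ-+ d (v + v) (u ∸ (v + v)) ⟨
        d * (v + v + (u ∸ (v + v)))      ≡⟨ cong (d *_) (ℕₚ.m+[n∸m]≡n 2v≤u) ⟩
        d * u                            ∎)) ⟩
      (d * u + v * n J) * c            ≡⟨ ℕₚ.*-distribʳ-+ c (d * u) (v * n J) ⟩
      d * u * c + D                    ∎)
      where
      open ℕₚ.≤-Reasoning
      w = d * (u ∸ (v + v))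

      e₁ : ∀ d u c → d * u * c + d ≡ d * (1 + u * c)
      e₁ = ℕ-Solver.solve-∀

      e₂ : ∀ d x n c v → (d + (d + (x + n))) * c * v ≡ (d * (v + v) + x * v + v * n) * c
      e₂ = ℕ-Solver.solve-∀

    -- As q ≥ 2, the approximation is closer than |h|⁻¹, as `Coded` demands.
    d<K : ∀ d K → d * a < K * c → d < K
    d<K d K da<Kc = ℕₚ.*-cancelʳ-< c d K (ℕₚ.≤-<-trans
      (ℕₚ.*-monoʳ-≤ d (ℕₚ.≤-trans (ℕₚ.m≤m+n c c) 2c≤a)) da<Kc)

    coded : ∀ x → Approximates ξ t x → Any (Coded x) (words D)
    coded x A =
      let open Approximates A
          open _IsQuotient_/_ x≐g/h
          d , e , (hd≢0 , h≡0) , vanish , da<Kc , K≤ = approximation-degree t q a Lq ↥q≡a x A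
          d<D = degree-bound d (suc e) da<Kc K≤
          w , w∈ , h≈w = words-complete D h (λ n D≤n → h≡0 n (ℕₚ.<-≤-trans d<D D≤n))
      in lose w∈ (d
        , ((λ wd≡0 → hd≢0 (trans (h≈w 1𝕂 (+ d)) wd≡0))
          , λ n d<n → trans (sym (h≈w 1𝕂 (+ n))) (h≡0 n d<n))
        , (λ k → trans (sym (h≈w x -[1+ k ])) (trans (h·x≈g -[1+ k ]) (ι-neg g k)))
        , λ i -d<i → vanish i (ℤₚ.≤-<-trans (ℤ.-≤- (ℕ.s≤s⁻¹ (d<K d (suc e) da<Kc))) -d<i))

-- Growth rate and diagonalisation

Below : ℝ ⁺ → ℚ → Set
Below ⊤⁺    q = ⊤
Below [ t ] q = L t q

<⁺⇒Below : ∀ {s} τ → [ s ] <⁺ τ → ∃[ q ] (U s q × Below τ q)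
<⁺⇒Below     [ t ] [ s<t ]   = s<t
<⁺⇒Below {s} ⊤⁺    [ .s ]<⊤⁺ = let q , Uq = ℝ.U-inhab s in q , Uq , tt

Below-rounded : ∀ τ {p} → Below τ p → ∃[ q ] (p ℚ.< q × Below τ q)
Below-rounded [ t ]  Lp = ℝ.L-rounded t Lp
Below-rounded ⊤⁺ {p} _  = let q , p<q = ℝ.U-inhab (fromℚ p) in q , p<q , tt

-- m j n / n tends to τ as j → ∞, uniformly in n ≥ j.
record Growth (τ : ℝ ⁺) : Set₁ where
  field
    m     : ℕ → ℕ → ℕ
    -- Strictness moves the sequence off n 0 = 0, and n < m leaves room for a digit 0 at m.
    2n<m  : ∀ j n → n + n < m j n
    lower : ∀ q → Below τ q → ∃[ J ] (∀ j n → J ≤ j → j ≤ n → + n ℤ.* ↥ q ℤ.< + m j n ℤ.* ↧ q)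
    -- The successor allows for moving the next index by one.
    upper : ∀ t → τ ≡ [ t ] → ∀ q a → U t q → ↥ q ≡ + a →
            ∃[ J ] (∀ j n → J ≤ j → j ≤ n → suc (m j n) * ↧ₙ q ≤ n * a)

growth-∞ : Growth ⊤⁺
growth-∞ = record
  { m     = λ j n → suc ((2 + j) * n)
  ; 2n<m  = λ j n → ℕ.s≤s (ℕₚ.+-monoʳ-≤ n (ℕₚ.m≤m+n n (j * n)))
  -- The ratio is at least j + 2, and q is at most the absolute value of its numerator.
  ; lower = λ q _ → ℤ.∣ ↥ q ∣ , λ j n ∣q∣≤j _ → begin-strict
      + n ℤ.* ↥ q                           ≤⟨ ℤₚ.*-monoˡ-≤-nonNeg (+ n) (i≤∣i∣ (↥ q)) ⟩
      + n ℤ.* + ℤ.∣ ↥ q ∣                   ≡⟨ ℤₚ.pos-* n ℤ.∣ ↥ q ∣ ⟨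
      + (n * ℤ.∣ ↥ q ∣)                     <⟨ ℤ.+<+ (ℕ.s≤s (ℕₚ.≤-trans
                                                 (ℕₚ.≤-reflexive (ℕₚ.*-comm n ℤ.∣ ↥ q ∣))
                                                 (ℕₚ.*-monoˡ-≤ n (ℕₚ.≤-trans ∣q∣≤j (ℕₚ.m≤n+m j 2))))) ⟩
      + suc ((2 + j) * n)                   ≤⟨ ℤ.+≤+ (ℕₚ.m≤m*n _ (↧ₙ q)) ⟩
      + (suc ((2 + j) * n) * ↧ₙ q)          ≡⟨ ℤₚ.pos-* (suc ((2 + j) * n)) (↧ₙ q) ⟩
      + suc ((2 + j) * n) ℤ.* ↧ q           ∎
  ; upper = λ _ ()
  }
  where
  open ℤₚ.≤-Reasoning
  i≤∣i∣ : ∀ i → i ℤ.≤ + ℤ.∣ i ∣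
  i≤∣i∣ (+ n)    = ℤₚ.≤-refl
  i≤∣i∣ -[1+ n ] = ℤ.-≤+

-- Comparison with unreduced fractions

<-fromℚᵘ⁺ : ∀ q x → ℚ.toℚᵘ q ℚᵘ.< x → q ℚ.< ℚ.fromℚᵘ x
<-fromℚᵘ⁺ q x q<x = ℚₚ.toℚᵘ-cancel-< (ℚᵘₚ.<-respʳ-≃ (ℚᵘₚ.≃-sym (ℚₚ.toℚᵘ-fromℚᵘ x)) q<x)

<-fromℚᵘ⁻ : ∀ q x → q ℚ.< ℚ.fromℚᵘ x → ℚ.toℚᵘ q ℚᵘ.< x
<-fromℚᵘ⁻ q x q<x = ℚᵘₚ.<-respʳ-≃ (ℚₚ.toℚᵘ-fromℚᵘ x) (ℚₚ.toℚᵘ-mono-< q<x)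

fromℚᵘ-<⁻ : ∀ q x → ℚ.fromℚᵘ x ℚ.< q → x ℚᵘ.< ℚ.toℚᵘ q
fromℚᵘ-<⁻ q x x<q = ℚᵘₚ.<-respˡ-≃ (ℚₚ.toℚᵘ-fromℚᵘ x) (ℚₚ.toℚᵘ-mono-< x<q)

fromℚᵘ-mono-< : ∀ {x y} → x ℚᵘ.< y → ℚ.fromℚᵘ x ℚ.< ℚ.fromℚᵘ y
fromℚᵘ-mono-< {x} {y} x<y = <-fromℚᵘ⁺ (ℚ.fromℚᵘ x) y (ℚᵘₚ.<-respˡ-≃ (ℚᵘₚ.≃-sym (ℚₚ.toℚᵘ-fromℚᵘ x)) x<y)

_/1+_ : ℕ → ℕ → ℚ
a /1+ n = ℚ.fromℚᵘ (mkℚᵘ (+ a) n)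

module _ (t : ℝ) (2≤t : [ fromℚ (+ 2 / 1) ] ≤⁺ [ t ]) where

  -- The hypothesis 2 ≤ t is a negation, so strictness comes from a rational p between t and q: p <
  -- 2 would give t < 2.
  U⇒2< : ∀ {q} → U t q → + 2 / 1 ℚ.< q
  U⇒2< Uq with ℝ.U-rounded t Uq
  ... | p , p<q , Up = ℚₚ.≤-<-trans (ℚₚ.≮⇒≥ λ p<2 → 2≤t [ p , Up , p<2 ]) p<q

  U⇒numerator : ∀ q → U t q → ∃[ a ] (↥ q ≡ + a × ↧ₙ q + ↧ₙ q < a)
  U⇒numerator q Uq = positive (↥ q) (ℚₚ.drop-*<* (U⇒2< Uq))
    where
    positive : ∀ i → + 2 ℤ.* ↧ q ℤ.< i ℤ.* 1ℤ → ∃[ a ] (i ≡ + a × ↧ₙ q + ↧ₙ q < a)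
    positive (+ a) 2c<a = a , refl , ℤₚ.drop‿+<+ (subst₂ ℤ._<_
      (trans (sym (ℤₚ.pos-* 2 (↧ₙ q))) (cong (λ c → + (↧ₙ q + c)) (ℕₚ.+-identityʳ (↧ₙ q))))
      (ℤₚ.*-identityʳ (+ a)) 2c<a)
    positive -[1+ a ] ()

  -- The ratio (1 + 2 n + k) / n exceeds t, by at most 2 / n unless k = 0.
  Close : ℕ → ℕ → Set
  Close n′ k = U t (suc (n + n + k) /1+ n′) ×
    (k ≡ 0 ⊎ ∃[ l ] (k ≡ suc l × L t ((n + n + l) /1+ n′)))
    where n = suc n′

  -- A real cannot be compared with a rational, only located between two. So k is lowered as long as
  -- the next ratio is certified to exceed t; otherwise the ratio below that one is certified to lie
  -- under t, which accounts for the 2 / n.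
  search : ∀ n′ k → U t (suc (suc n′ + suc n′ + k) /1+ n′) → ∃ (Close n′)
  search n′ zero    Uk = 0 , Uk , inj₁ refl
  search n′ (suc k) Uk with ℝ.located t (fromℚᵘ-mono-< {mkℚᵘ (+ (n + n + k)) n′} {mkℚᵘ (+ suc (n + n + k)) n′}
      (ℚᵘ.*<* (ℤₚ.*-monoʳ-<-pos (+ n) (ℤ.+<+ (ℕₚ.n<1+n (n + n + k))))))
    where n = suc n′
  ... | inj₁ Lk = suc k , Uk , inj₂ (k , refl , Lk)
  ... | inj₂ U′ = search n′ k U′

  close : ∀ n′ → ∃ (Close n′)
  close n′ with ℝ.U-inhab t
  ... | q@record{} , Uq with U⇒numerator q Uq
  -- The starting ratio exceeds a ≥ q, hence t.
  ...   | a , ↥q≡a , _ = search n′ (n * a) (ℝ.U-upper t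
    (<-fromℚᵘ⁺ q (mkℚᵘ (+ suc (n + n + n * a)) n′) (ℚᵘ.*<* (begin-strict
    ↥ q ℤ.* + n                      ≡⟨ cong (ℤ._* + n) ↥q≡a ⟩
    + a ℤ.* + n                      ≡⟨ ℤₚ.pos-* a n ⟨
    + (a * n)                        ≡⟨ cong +_ (ℕₚ.*-comm a n) ⟩
    + (n * a)                        <⟨ ℤ.+<+ (ℕ.s≤s (ℕₚ.m≤n+m (n * a) (n + n))) ⟩
    + suc (n + n + n * a)            ≤⟨ ℤ.+≤+ (ℕₚ.m≤m*n _ (↧ₙ q)) ⟩
    + (suc (n + n + n * a) * ↧ₙ q)   ≡⟨ ℤₚ.pos-* (suc (n + n + n * a)) (↧ₙ q) ⟩
    + suc (n + n + n * a) ℤ.* ↧ q    ∎))) Uq)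
    where
    open ℤₚ.≤-Reasoning
    n = suc n′

  closest : ℕ → ℕ
  -- No ratio exists at n = 0; the value 1 satisfies 0 + 0 < 1.
  closest zero     = 1
  closest (suc n′) = suc (suc n′ + suc n′ + proj₁ (close n′))

  growth-ℝ : Growth [ t ]
  growth-ℝ = record
    { m     = λ _ → closest
    ; 2n<m  = λ _ → 2n<closest
    ; lower = λ q Lq → 1 , λ { j (suc n′) 1≤j j≤n → lower q Lq n′ ; (suc j) zero 1≤j () }
    ; upper = λ { t refl q a Uq ↥q≡a → upper q a Uq ↥q≡a }
    }
    where
    2n<closest : ∀ n → n + n < closest n
    2n<closest zero     = ℕ.s≤s ℕ.z≤n
    2n<closest (suc n′) = ℕ.s≤s (ℕₚ.m≤m+n (suc n′ + suc n′) _)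

    lower : ∀ q → L t q → ∀ n′ → + suc n′ ℤ.* ↥ q ℤ.< + closest (suc n′) ℤ.* ↧ q
    lower q@record{} Lq n′ = let _ , U-closest , _ = close n′ in
      subst (ℤ._< + closest (suc n′) ℤ.* ↧ q) (ℤₚ.*-comm (↥ q) (+ suc n′))
        (ℚᵘₚ.drop-*<* (<-fromℚᵘ⁻ q (mkℚᵘ (+ closest (suc n′)) n′) (L<U t Lq U-closest)))

    upper : ∀ q a → U t q → ↥ q ≡ + a →
      ∃[ J ] (∀ j n → J ≤ j → j ≤ n → suc (closest n) * ↧ₙ q ≤ n * a)
    upper q a Uq ↥q≡a with ℝ.U-rounded t Uq
    ... | p@record{} , p<q , Up with U⇒numerator p Up | U⇒numerator q Uq
    -- When k = suc l, `suc (closest n)` is 3 more than 2 n + l, and (2 n + l) / n < p. As q - p ≥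
    -- 1/(c d), the excess 3 / n is absorbed once n ≥ 3 c d; the case k = 0 needs only n ≥ 2 c.
    ...   | b , ↥p≡b , _ | a′ , ↥q≡a′ , 2c<a′ = 3 * c * d , λ j n J≤j j≤n →
      scaled n (ℕₚ.≤-trans J≤j j≤n)
      where
      open ℕₚ.≤-Reasoning
      c = ↧ₙ q
      d = ↧ₙ p

      2c<a : c + c < a
      2c<a = subst (c + c <_) (ℤₚ.+-injective (trans (sym ↥q≡a′) ↥q≡a)) 2c<a′

      bc<ad : b * c < a * d
      bc<ad = ℤₚ.drop‿+<+ (subst₂ ℤ._<_
        (trans (cong (ℤ._* ↧ q) ↥p≡b) (sym (ℤₚ.pos-* b c)))
        (trans (cong (ℤ._* ↧ p) ↥q≡a) (sym (ℤₚ.pos-* a d))) (ℚₚ.drop-*<* p<q))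

      scaled : ∀ n → 3 * c * d ≤ n → suc (closest n) * c ≤ n * a
      scaled zero     ()
      scaled (suc n′) 3cd≤n with close n′
      ... | _ , _ , inj₁ refl = begin
        suc (suc (n + n + 0)) * c     ≡⟨ e₁ n c ⟩
        2 * c * 1 + n * (c + c)       ≤⟨ ℕₚ.+-monoˡ-≤ (n * (c + c)) (ℕₚ.≤-trans
                                          (ℕₚ.*-mono-≤ (ℕₚ.*-monoˡ-≤ c (ℕₚ.n≤1+n 2)) (ℕ.s≤s ℕ.z≤n)) 3cd≤n) ⟩
        n + n * (c + c)               ≡⟨ ℕₚ.*-suc n (c + c) ⟨
        n * suc (c + c)               ≤⟨ ℕₚ.*-monoʳ-≤ n 2c<a ⟩
        n * a                         ∎
        where
        n = suc n′
        e₁ : ∀ n c → (1 + (1 + (n + n + 0))) * c ≡ 2 * c * 1 + n * (c + c)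
        e₁ = ℕ-Solver.solve-∀
      ... | _ , _ , inj₂ (l , refl , Ll) = ℕₚ.*-cancelʳ-≤ _ _ d (begin
        suc (suc (n + n + suc l)) * c * d     ≡⟨ e₂ n l c d ⟩
        3 * c * d + (n + n + l) * d * c       ≤⟨ ℕₚ.+-mono-≤ 3cd≤n (ℕₚ.*-monoˡ-≤ c (ℕₚ.<⇒≤ l<bn)) ⟩
        n + b * n * c                         ≡⟨ e₃ n b c ⟩
        n * suc (b * c)                       ≤⟨ ℕₚ.*-monoʳ-≤ n bc<ad ⟩
        n * (a * d)                           ≡⟨ ℕₚ.*-assoc n a d ⟨
        n * a * d                             ∎)
        where
        n = suc n′

        l<bn : (n + n + l) * d < b * n
        l<bn = ℤₚ.drop‿+<+ (subst₂ ℤ._<_ (sym (ℤₚ.pos-* (n + n + l) d))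
          (trans (cong (ℤ._* + n) ↥p≡b) (sym (ℤₚ.pos-* b n)))
          (ℚᵘₚ.drop-*<* (fromℚᵘ-<⁻ p (mkℚᵘ (+ (n + n + l)) n′) (L<U t Ll Up))))

        e₂ : ∀ n l c d → (1 + (1 + (n + n + (1 + l)))) * c * d ≡ 3 * c * d + (n + n + l) * d * c
        e₂ = ℕ-Solver.solve-∀

        e₃ : ∀ n b c → n + b * n * c ≡ n * (1 + b * c)
        e₃ = ℕ-Solver.solve-∀

growth : ∀ τ → [ fromℚ (+ 2 / 1) ] ≤⁺ τ → Growth τ
growth ⊤⁺    _   = growth-∞
growth [ t ] 2≤t = growth-ℝ t 2≤t

-- The diagonal series and its exponent

module Diagonal (τ : ℝ ⁺) (2≤τ : [ fromℚ (+ 2 / 1) ] ≤⁺ τ) (f : ℕ → 𝕂) where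

  open Growth (growth τ 2≤τ)

  -- Makes the digit of ξ at X^(-m j n) equal to 2 or 0, whichever f j does not have there.
  next : ℕ → ℕ → ℕ
  next j n with coeff (f j) (ℤ.- + m j n) Finₚ.≟ 0F
  ... | yes _ = m j n
  ... | no _  = suc (m j n)

  next-cases : ∀ j n →
    (next j n ≡ m j n × coeff (f j) (ℤ.- + m j n) ≡ 0F) ⊎
    (next j n ≡ suc (m j n) × coeff (f j) (ℤ.- + m j n) ≢ 0F)
  next-cases j n with coeff (f j) (ℤ.- + m j n) Finₚ.≟ 0F
  ... | yes ≡0 = inj₁ (refl , ≡0)
  ... | no ≢0  = inj₂ (refl , ≢0)

  m≤next : ∀ j n → m j n ≤ next j n
  m≤next j n with next-cases j n
  ... | inj₁ (eq , _) = ℕₚ.≤-reflexive (sym eq)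
  ... | inj₂ (eq , _) = ℕₚ.≤-trans (ℕₚ.n≤1+n _) (ℕₚ.≤-reflexive (sym eq))

  next≤1+m : ∀ j n → next j n ≤ suc (m j n)
  next≤1+m j n with next-cases j n
  ... | inj₁ (eq , _) = ℕₚ.≤-trans (ℕₚ.≤-reflexive eq) (ℕₚ.n≤1+n _)
  ... | inj₂ (eq , _) = ℕₚ.≤-reflexive eq

  n : ℕ → ℕ
  n zero    = 0
  n (suc j) = next j (n j)

  double< : ∀ j → n j + n j < n (suc j)
  double< j = ℕₚ.<-≤-trans (2n<m j (n j)) (m≤next j (n j))

  double : ∀ j → n j + n j ≤ n (suc j)
  double j = ℕₚ.<⇒≤ (double< j)

  n-step : ∀ j → n j < n (suc j)
  n-step j = ℕₚ.≤-<-trans (ℕₚ.m≤m+n (n j) (n j)) (double< j)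

  open Lacunary n refl double n-step

  ξ≉f : ∀ j → ¬ (ξ ≈ f j)
  ξ≉f j ξ≈f with next-cases j (n j)
  ... | inj₁ (eq , f≡0) = contradiction
    (trans (sym (ξ-pos j)) (trans (ξ≈f (pos (suc j))) (trans (cong (λ k → coeff (f j) (ℤ.- + k)) eq) f≡0)))
    λ ()
  ... | inj₂ (eq , f≢0) = f≢0 (trans (sym (ξ≈f _)) (ξ-gap j (m j (n j))
    (ℕₚ.≤-<-trans (ℕₚ.m≤m+n (n j) (n j)) (2n<m j (n j))) (ℕₚ.≤-reflexive (sym eq))))

  exceeds : ∀ q → Below τ q → ∃[ J ] (∀ j → J ≤ j → Exceeds j q)
  exceeds q τ>q = let J , n*q< = lower q τ>q in
    J , λ j J≤j → ℤₚ.<-≤-trans (n*q< j (n j) J≤j (j≤n j))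
      (ℤₚ.*-monoʳ-≤-nonNeg (↧ q) (ℤ.+≤+ (m≤next j (n j))))

  least : ∀ s → [ s ] <⁺ τ → ∃[ t ] (Infinite 𝕂-setoid (Approximates ξ t) × s <ℝ t)
  least s s<τ =
    -- Three rationals s < p < q < r < τ: p witnesses s < q, q is the exponent attained, and r is
    -- the upper end needed around q.
    let p , Up , p<τ  = <⁺⇒Below τ s<τ
        q , p<q , q<τ = Below-rounded τ p<τ
        r , q<r , r<τ = Below-rounded τ q<τ
    in fromℚ q , infinite-approximations q<r (exceeds r r<τ) , p , Up , p<q

  -- If τ < t, choose rationals τ < p < q < t. The ratios are eventually at most p, and
  -- approximations of exponent beyond q > p are finite in number.
  upperBound : ∀ t → Infinite 𝕂-setoid (Approximates ξ t) → [ t ] ≤⁺ τ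
  upperBound t infinite τ<t = go τ refl 2≤τ τ<t
    where
    go : ∀ σ → τ ≡ σ → [ fromℚ (+ 2 / 1) ] ≤⁺ σ → ¬ (σ <⁺ [ t ])
    -- Nothing exceeds ∞, so τ is a real number σ here.
    go [ σ ] τ≡σ 2≤σ [ q , Uq , Lq ] with ℝ.U-rounded σ Uq
    ... | p , p<q , Up with U⇒numerator σ 2≤σ p Up | U⇒numerator σ 2≤σ q Uq
    ...   | u , ↥p≡u , 2v<u | a , ↥q≡a , 2c<a with upper σ τ≡σ p u Up ↥p≡u
    ...     | J , ratio = finitely-many-approximations t q a Lq ↥q≡a (ℕₚ.<⇒≤ 2c<a) uc<av infinite
      where
      open LacunaryBound n refl double n-step u (↧ₙ p) J (ℕₚ.<⇒≤ 2v<u)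
        (λ j J≤j → ℕₚ.≤-trans (ℕₚ.*-monoˡ-≤ (↧ₙ p) (next≤1+m j (n j))) (ratio j (n j) J≤j (j≤n j)))

      uc<av : u * ↧ₙ q < a * ↧ₙ p
      uc<av = ℤₚ.drop‿+<+ (subst₂ ℤ._<_
        (trans (cong (ℤ._* ↧ q) ↥p≡u) (sym (ℤₚ.pos-* u (↧ₙ q))))
        (trans (cong (ℤ._* ↧ p) ↥q≡a) (sym (ℤₚ.pos-* a (↧ₙ p)))) (ℚₚ.drop-*<* p<q))

corollary9 : (τ : ℝ ⁺) → [ fromℚ (+ 2 / 1) ] ≤⁺ τ →
    Uncountable 𝕂-setoid (λ ξ → Cantor ξ × IrrationalityExponent ξ τ)
corollary9 τ 2≤τ f = ξ , (ξ-cantor , record { upperBound = upperBound ; least = least }) , ξ≉f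
  where
  open Diagonal τ 2≤τ f
  open Lacunary n refl double n-step
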